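{- Let $C\subset\mathbb{F}_2^n$ be any binary linear code, let $d\ge 0$ be an integer, and let $Q\in\mathcal{D}_d^0$ be a discrete harmonic polynomial of degree $d$. Then the harmonic weight enumerator $W_{C,Q}(x,y)=\sum_{c\in C}Q(c)x^{n-\mathrm{wt}(c)}y^{\mathrm{wt}(c)}$ satisfies the identity $$W_{C,Q}(x,y)=\left(-\frac{xy}{x^2-y^2}\right)^{d}\cdot\frac{2^{\frac n2+d}}{|C^\perp|}\cdot W_{C^\perp,Q}\left(\frac{x+y}{\sqrt2},\frac{x-y}{\sqrt2}\right).$$
   Context: A binary linear code of length $n$ is a vector subspace $C\subseteq\mathbb{F}_2^n$; $\mathrm{wt}(c)$ is the number of nonzero coordinates of $c$; $C^\perp$ is the annihilator of $C$ with respect to $(v,w)=\sum_j v_jw_j$ on $\mathbb{F}_2^n$. For any code $C$ and function $Q:\mathbb{F}_2^n\to\mathbb{C}$, $W_{C,Q}(x,y):=\sum_{c\in C}Q(c)x^{n-\mathrm{wt}(c)}y^{\mathrm{wt}(c)}$. Discrete harmonic polynomials: functions $\mathbb{F}_2^n\to\mathbb{C}$ are identified with $(\mathbb{C}^2)^{\otimes n}$, the pure tensor $\binom{g_{10}}{g_{11}}\otimes\cdots\otimes\binom{g_{n0}}{g_{n1}}$ being the function $v\mapsto g_{1v_1}\cdots g_{nv_n}$. Let $\mathcal{D}_d$ be the complex span of the functions $v\mapsto\prod_{j\in J}(-1)^{v_j}$ with $J\subseteq\{1,\dots,n\}$, $|J|=d$ ($\mathcal{D}_d=\{0\}$ for $d<0$).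 Let $X'=\tfrac12\begin{pmatrix}1&-1\\1&-1\end{pmatrix}$ and $\tilde X'=\sum_{j=1}^n I\otimes\cdots\otimes X'\otimes\cdots\otimes I$ ($X'$ in the $j$-th factor). Then $\tilde X'$ maps $\mathcal{D}_d$ to $\mathcal{D}_{d-1}$, and $\mathcal{D}_d^0:=\ker(\tilde X':\mathcal{D}_d\to\mathcal{D}_{d-1})$ is the space of degree-$d$ discrete harmonic polynomials. -}

module Defs where

open import Algebra.Bundles using (CommutativeRing; Semiring)
open import Data.Bool.Base using (if_then_else_)
open import Data.Nat.Base as ℕ using (ℕ; zero; suc)
import Data.Nat.Properties as ℕ
open import Data.Product.Base using (∃; _,_; _×_; proj₂)
open import Data.Sum.Base using (_⊎_; inj₁; inj₂)
open import Level using (0ℓ)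
open import Relation.Binary.PropositionalEquality as ≡ using (_≡_; refl)
open import Relation.Nullary.Decidable using (Dec; does; yes; no; map′; ¬?; dec⇒maybe)
open import Relation.Nullary.Negation using (contradiction)
open import Tactic.RingSolver using (solve-∀)
open import Tactic.RingSolver.Core.AlmostCommutativeRing
  using (AlmostCommutativeRing; fromCommutativeRing)

------------------------------------------------------------------------
-- Real numbers: Cauchy sequences of rationals

module Reals where

  open import Algebra.Structures using (IsCommutativeRing)
  open import Data.Integer.Base as ℤ using (+_; +[1+_]; -[1+_])
  import Data.Integer.Properties as ℤ
  open import Data.Rational hiding (_≃_)
  open import Data.Rational.Properties hiding (≃-sym)
  import Data.Rational.Unnormalised as ℚᵘ
  import Data.Rational.Unnormalised.Properties as ℚᵘ

  private
    ℚ-ring : AlmostCommutativeRing 0ℓ 0ℓ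
    ℚ-ring = fromCommutativeRing +-*-commutativeRing (λ q → dec⇒maybe (0ℚ ≟ q))

    0<1 : 0ℚ < 1ℚ
    0<1 = positive⁻¹ 1ℚ

    0<+ : ∀ {p q} → 0ℚ < p → 0ℚ < q → 0ℚ < p + q
    0<+ {p} {q} 0<p 0<q =
      positive⁻¹ (p + q) {{pos+pos⇒pos p {{positive 0<p}} q {{positive 0<q}}}}

    0<* : ∀ {p q} → 0ℚ < p → 0ℚ < q → 0ℚ < p * q
    0<* {p} {q} 0<p 0<q =
      positive⁻¹ (p * q) {{pos*pos⇒pos p {{positive 0<p}} q {{positive 0<q}}}}

    *-monoˡ : ∀ {p q r} → 0ℚ ≤ r → p ≤ q → r * p ≤ r * q
    *-monoˡ {r = r} 0≤r = *-monoˡ-≤-nonNeg r {{nonNegative 0≤r}}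

    *-mono : ∀ p q r s → 0ℚ ≤ p → 0ℚ ≤ s → p ≤ q → r ≤ s → p * r ≤ q * s
    *-mono p q r s 0≤p 0≤s p≤q r≤s = ≤-trans (*-monoˡ 0≤p r≤s)
      (*-monoʳ-≤-nonNeg s {{nonNegative 0≤s}} p≤q)

    0≤p*p : ∀ p → 0ℚ ≤ p * p
    0≤p*p p with ≤-total 0ℚ p
    ... | inj₁ 0≤p = ≤-trans (≤-reflexive (≡.sym (*-zeroʳ p))) (*-monoˡ 0≤p 0≤p)
    ... | inj₂ p≤0 = ≤-trans (≤-reflexive (≡.sym (*-zeroʳ p)))
                       (*-monoˡ-≤-nonPos p {{nonPositive p≤0}} p≤0)

    p≤∣p∣ : ∀ p → p ≤ ∣ p ∣
    p≤∣p∣ p with ≤-total 0ℚ p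
    ... | inj₁ 0≤p = ≤-reflexive (≡.sym (0≤p⇒∣p∣≡p 0≤p))
    ... | inj₂ p≤0 = ≤-trans p≤0 (0≤∣p∣ p)

    recip : ∀ {p} → 0ℚ < p → ∃ λ r → 0ℚ < r × p * r ≡ 1ℚ
    recip {p} 0<p = (1/ p) {{>-nonZero 0<p}} ,
      positive⁻¹ _ {{1/pos⇒pos p {{positive 0<p}}}} ,
      *-inverseʳ p {{>-nonZero 0<p}}

    ∣p-q∣<r : ∀ {p q r} → p < q + r → q < p + r → ∣ p - q ∣ < r
    ∣p-q∣<r {p} {q} {r} p<q+r q<p+r with ∣p∣≡p∨∣p∣≡-p (p - q)
    ... | inj₁ eq = ≡.subst₂ _<_ (≡.sym eq) (lem q r) (+-monoˡ-< (- q) p<q+r)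
      where lem : ∀ q r → q + r - q ≡ r
            lem = solve-∀ ℚ-ring
    ... | inj₂ eq = ≡.subst₂ _<_ (≡.trans (lem₁ q p) (≡.sym eq)) (lem p r) (+-monoˡ-< (- p) q<p+r)
      where lem : ∀ q r → q + r - q ≡ r
            lem = solve-∀ ℚ-ring
            lem₁ : ∀ q p → q - p ≡ - (p - q)
            lem₁ = solve-∀ ℚ-ring

  infix 4 _~_

  -- On Cauchy sequences x ~ y says that x n - y n tends to 0, and x ~ x is
  -- the Cauchy condition itself.
  record _~_ (x y : ℕ → ℚ) : Set where
    constructor mk~
    field
      within : ∀ {ε} → 0ℚ < ε →
               ∃ λ N → ∀ {m n} → N ℕ.≤ m → N ℕ.≤ n → ∣ x m - y n ∣ < ε

  open _~_

  record ℝ : Set where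
    constructor mkℝ
    field
      seq    : ℕ → ℚ
      cauchy : seq ~ seq

  open ℝ

  infix 4 _≃_

  record _≃_ (x y : ℝ) : Set where
    constructor mk≃
    field
      close : seq x ~ seq y

  private
    scaled : ∀ {x y K} → 0ℚ < K →
             (∀ {δ} → 0ℚ < δ →
               ∃ λ N → ∀ {m n} → N ℕ.≤ m → N ℕ.≤ n → ∣ x m - y n ∣ ≤ K * δ) →
             x ~ y
    scaled {x} {y} {K} 0<K H .within {ε} 0<ε =
      let ρ , 0<ρ , ρ<ε = <-dense 0<ε
          r , 0<r , Kr≡1 = recip 0<K
          N , h = H (0<* 0<r 0<ρ)
      in N , λ N≤m N≤n → ≤-<-trans (h N≤m N≤n) (≤-<-trans (≤-reflexive (eq r ρ Kr≡1)) ρ<ε)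
      where
      eq : ∀ r ρ → K * r ≡ 1ℚ → K * (r * ρ) ≡ ρ
      eq r ρ Kr≡1 = ≡.trans (≡.sym (*-assoc K r ρ))
                      (≡.trans (≡.cong (_* ρ) Kr≡1) (*-identityˡ ρ))

    ~-sym : ∀ {x y} → x ~ y → y ~ x
    ~-sym {x} {y} p .within 0<ε =
      let N , h = within p 0<ε
      in N , λ {m} {n} N≤m N≤n → ≤-<-trans (≤-reflexive (lem (x n) (y m))) (h N≤n N≤m)
      where
      eq : ∀ a b → b - a ≡ - (a - b)
      eq = solve-∀ ℚ-ring
      lem : ∀ a b → ∣ b - a ∣ ≡ ∣ a - b ∣
      lem a b = ≡.trans (≡.cong ∣_∣ (eq a b)) (∣-p∣≡∣p∣ (a - b))

    ∣p+q∣≤2δ : ∀ p q δ → ∣ p ∣ ≤ δ → ∣ q ∣ ≤ δ → ∣ p + q ∣ ≤ (1ℚ + 1ℚ) * δ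
    ∣p+q∣≤2δ p q δ p≤ q≤ = begin
      ∣ p + q ∣       ≤⟨ ∣p+q∣≤∣p∣+∣q∣ p q ⟩
      ∣ p ∣ + ∣ q ∣   ≤⟨ +-mono-≤ p≤ q≤ ⟩
      δ + δ           ≡⟨ lem δ ⟩
      (1ℚ + 1ℚ) * δ   ∎
      where
      open ≤-Reasoning
      lem : ∀ δ → δ + δ ≡ (1ℚ + 1ℚ) * δ
      lem = solve-∀ ℚ-ring

    ~-trans : ∀ {x y z} → x ~ y → y ~ z → x ~ z
    ~-trans {x} {y} {z} p q = scaled (0<+ 0<1 0<1) λ {δ} 0<δ →
      let M , h = within p 0<δ
          N , k = within q 0<δ
          L = M ℕ.⊔ N
      in L , λ {m} {n} ≤m ≤n →
      ≤-trans (≤-reflexive (≡.cong ∣_∣ (lem (x m) (y L) (z n))))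
        (∣p+q∣≤2δ (x m - y L) (y L - z n) δ
          (<⇒≤ (h (ℕ.m⊔n≤o⇒m≤o M N ≤m) (ℕ.m≤m⊔n M N)))
          (<⇒≤ (k (ℕ.m≤n⊔m M N) (ℕ.m⊔n≤o⇒n≤o M N ≤n))))
      where
      lem : ∀ a b c → a - c ≡ (a - b) + (b - c)
      lem = solve-∀ ℚ-ring

    ~-pointwise : ∀ {x y z} → x ~ z → (∀ n → z n ≡ y n) → x ~ y
    ~-pointwise {x} p eq .within 0<ε =
      let N , h = within p 0<ε
      in N , λ {m} {n} N≤m N≤n →
           ≤-<-trans (≤-reflexive (≡.cong (λ q → ∣ x m - q ∣) (≡.sym (eq n)))) (h N≤m N≤n)

    +-~ : ∀ {x x′ y y′} → x ~ x′ → y ~ y′ → (λ n → x n + y n) ~ (λ n → x′ n + y′ n)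
    +-~ {x} {x′} {y} {y′} p q = scaled (0<+ 0<1 0<1) λ {δ} 0<δ →
      let M , h = within p 0<δ
          N , k = within q 0<δ
      in M ℕ.⊔ N , λ {m} {n} ≤m ≤n →
      ≤-trans (≤-reflexive (≡.cong ∣_∣ (lem (x m) (y m) (x′ n) (y′ n))))
        (∣p+q∣≤2δ (x m - x′ n) (y m - y′ n) δ
          (<⇒≤ (h (ℕ.m⊔n≤o⇒m≤o M N ≤m) (ℕ.m⊔n≤o⇒m≤o M N ≤n)))
          (<⇒≤ (k (ℕ.m⊔n≤o⇒n≤o M N ≤m) (ℕ.m⊔n≤o⇒n≤o M N ≤n))))
      where
      lem : ∀ a b c d → (a + b) - (c + d) ≡ (a - c) + (b - d)
      lem = solve-∀ ℚ-ring

    neg-~ : ∀ {x y} → x ~ y → (λ n → - x n) ~ (λ n → - y n)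
    neg-~ {x} {y} p .within 0<ε =
      let N , h = within p 0<ε
      in N , λ {m} {n} N≤m N≤n → ≤-<-trans (≤-reflexive (lem (x m) (y n))) (h N≤m N≤n)
      where
      eq : ∀ a b → - a - - b ≡ - (a - b)
      eq = solve-∀ ℚ-ring
      lem : ∀ a b → ∣ - a - - b ∣ ≡ ∣ a - b ∣
      lem a b = ≡.trans (≡.cong ∣_∣ (eq a b)) (∣-p∣≡∣p∣ (a - b))

    bounded : ∀ {x y} → x ~ y →
              ∃ λ B → 0ℚ < B × ∃ λ N → ∀ {m} → N ℕ.≤ m → ∣ x m ∣ ≤ B
    bounded {x} {y} p =
      let N , h = within p 0<1
      in 1ℚ + ∣ y N ∣ , +-mono-<-≤ 0<1 (0≤∣p∣ (y N)) , N ,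
         λ {m} N≤m → lem (x m) (y N) (<⇒≤ (h N≤m ℕ.≤-refl))
      where
      open ≤-Reasoning
      eq : ∀ a b → a ≡ (a - b) + b
      eq = solve-∀ ℚ-ring
      lem : ∀ a b → ∣ a - b ∣ ≤ 1ℚ → ∣ a ∣ ≤ 1ℚ + ∣ b ∣
      lem a b a-b≤1 = begin
        ∣ a ∣                 ≡⟨ ≡.cong ∣_∣ (eq a b) ⟩
        ∣ (a - b) + b ∣       ≤⟨ ∣p+q∣≤∣p∣+∣q∣ (a - b) b ⟩
        ∣ a - b ∣ + ∣ b ∣     ≤⟨ +-monoˡ-≤ (∣ b ∣) a-b≤1 ⟩
        1ℚ + ∣ b ∣            ∎

    *-close : ∀ a b c d B B′ δ → 0ℚ ≤ δ → ∣ b ∣ ≤ B → ∣ c ∣ ≤ B′ →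
              ∣ a - c ∣ ≤ δ → ∣ b - d ∣ ≤ δ → ∣ a * b - c * d ∣ ≤ (B + B′) * δ
    *-close a b c d B B′ δ 0≤δ b≤ c≤ a-c≤ b-d≤ = begin
      ∣ a * b - c * d ∣
        ≡⟨ ≡.cong ∣_∣ (lem a b c d) ⟩
      ∣ b * (a - c) + c * (b - d) ∣
        ≤⟨ ∣p+q∣≤∣p∣+∣q∣ (b * (a - c)) (c * (b - d)) ⟩
      ∣ b * (a - c) ∣ + ∣ c * (b - d) ∣
        ≡⟨ ≡.cong₂ _+_ (∣p*q∣≡∣p∣*∣q∣ b (a - c)) (∣p*q∣≡∣p∣*∣q∣ c (b - d)) ⟩
      ∣ b ∣ * ∣ a - c ∣ + ∣ c ∣ * ∣ b - d ∣
        ≤⟨ +-mono-≤ (*-mono (∣ b ∣) B (∣ a - c ∣) δ (0≤∣p∣ b) 0≤δ b≤ a-c≤)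
                    (*-mono (∣ c ∣) B′ (∣ b - d ∣) δ (0≤∣p∣ c) 0≤δ c≤ b-d≤) ⟩
      B * δ + B′ * δ
        ≡⟨ *-distribʳ-+ δ B B′ ⟨
      (B + B′) * δ ∎
      where
      open ≤-Reasoning
      lem : ∀ a b c d → a * b - c * d ≡ b * (a - c) + c * (b - d)
      lem = solve-∀ ℚ-ring

    *-~ : ∀ {x x′ y y′} → x ~ x′ → y ~ y′ → (λ n → x n * y n) ~ (λ n → x′ n * y′ n)
    *-~ {x} {x′} {y} {y′} p q =
      let B  , 0<B  , J  , b  = bounded q
          B′ , 0<B′ , J′ , b′ = bounded (~-sym p)
      in scaled (0<+ 0<B 0<B′) λ {δ} 0<δ →
      let M , h = within p 0<δ
          N , k = within q 0<δ
          JM = J ℕ.⊔ M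
          JN = J′ ℕ.⊔ N
      in JM ℕ.⊔ JN , λ {m} {n} ≤m ≤n →
      *-close (x m) (y m) (x′ n) (y′ n) B B′ δ (<⇒≤ 0<δ)
        (b (ℕ.m⊔n≤o⇒m≤o J M (ℕ.m⊔n≤o⇒m≤o JM JN ≤m)))
        (b′ (ℕ.m⊔n≤o⇒m≤o J′ N (ℕ.m⊔n≤o⇒n≤o JM JN ≤n)))
        (<⇒≤ (h (ℕ.m⊔n≤o⇒n≤o J M (ℕ.m⊔n≤o⇒m≤o JM JN ≤m))
                (ℕ.m⊔n≤o⇒n≤o J M (ℕ.m⊔n≤o⇒m≤o JM JN ≤n))))
        (<⇒≤ (k (ℕ.m⊔n≤o⇒n≤o J′ N (ℕ.m⊔n≤o⇒n≤o JM JN ≤m))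
                (ℕ.m⊔n≤o⇒n≤o J′ N (ℕ.m⊔n≤o⇒n≤o JM JN ≤n))))

    const-~ : ∀ q → (λ _ → q) ~ (λ _ → q)
    const-~ q .within 0<ε = 0 , λ _ _ →
      ≤-<-trans (≤-reflexive (≡.cong ∣_∣ (+-inverseʳ q))) 0<ε

  infixl 6 _+ʳ_
  infixl 7 _*ʳ_
  infix  8 -ʳ_

  -- The operations are opaque so that rational arithmetic is not unfolded when
  -- types are compared.
  opaque

    fromℚ : ℚ → ℝ
    fromℚ q = mkℝ (λ _ → q) (const-~ q)

    _+ʳ_ : ℝ → ℝ → ℝ
    x +ʳ y = mkℝ (λ n → seq x n + seq y n) (+-~ (cauchy x) (cauchy y))

    _*ʳ_ : ℝ → ℝ → ℝ
    x *ʳ y = mkℝ (λ n → seq x n * seq y n) (*-~ (cauchy x) (cauchy y))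

    -ʳ_ : ℝ → ℝ
    -ʳ x = mkℝ (λ n → - seq x n) (neg-~ (cauchy x))

  pointwise : ∀ {x y} → (∀ n → seq x n ≡ seq y n) → x ≃ y
  pointwise {x} eq = mk≃ (~-pointwise (cauchy x) eq)

  opaque
    unfolding fromℚ

    ½+½ʳ : fromℚ ½ +ʳ fromℚ ½ ≃ fromℚ 1ℚ
    ½+½ʳ = pointwise λ _ → refl

    isCommutativeRing : IsCommutativeRing _≃_ _+ʳ_ _*ʳ_ -ʳ_ (fromℚ 0ℚ) (fromℚ 1ℚ)
    isCommutativeRing = record
      { isRing = record
        { +-isAbelianGroup = record
          { isGroup = record
            { isMonoid = record
              { isSemigroup = record
                { isMagma = record
                  { isEquivalence = record
                    { refl  = λ {x} → mk≃ (cauchy x)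
                    ; sym   = λ { (mk≃ p) → mk≃ (~-sym p) }
                    ; trans = λ { (mk≃ p) (mk≃ q) → mk≃ (~-trans p q) }
                    }
                  ; ∙-cong = λ { (mk≃ p) (mk≃ q) → mk≃ (+-~ p q) }
                  }
                ; assoc = λ x y z → pointwise λ n → +-assoc (seq x n) (seq y n) (seq z n)
                }
              ; identity = (λ x → pointwise λ n → +-identityˡ (seq x n))
                         , (λ x → pointwise λ n → +-identityʳ (seq x n))
              }
            ; inverse = (λ x → pointwise λ n → +-inverseˡ (seq x n))
                      , (λ x → pointwise λ n → +-inverseʳ (seq x n))
            ; ⁻¹-cong = λ { (mk≃ p) → mk≃ (neg-~ p) }
            }
          ; comm = λ x y → pointwise λ n → +-comm (seq x n) (seq y n)
          }
        ; *-cong = λ { (mk≃ p) (mk≃ q) → mk≃ (*-~ p q) }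
        ; *-assoc = λ x y z → pointwise λ n → *-assoc (seq x n) (seq y n) (seq z n)
        ; *-identity = (λ x → pointwise λ n → *-identityˡ (seq x n))
                     , (λ x → pointwise λ n → *-identityʳ (seq x n))
        ; distrib = (λ x y z → pointwise λ n → *-distribˡ-+ (seq x n) (seq y n) (seq z n))
                  , (λ x y z → pointwise λ n → *-distribʳ-+ (seq x n) (seq y n) (seq z n))
        }
      ; *-comm = λ x y → pointwise λ n → *-comm (seq x n) (seq y n)
      }

  ℝ-commutativeRing : CommutativeRing 0ℓ 0ℓ
  ℝ-commutativeRing = record { isCommutativeRing = isCommutativeRing }

  infix 4 _#0

  -- x #0 is apartness from zero, the constructive form of x ≠ 0.
  record _#0 (x : ℝ) : Set where
    constructor mk#
    field
      {bound} : ℚ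
      0<bound : 0ℚ < bound
      from    : ℕ
      bound≤  : ∀ {n} → from ℕ.≤ n → bound ≤ ∣ seq x n ∣

  private
    inv : ℚ → ℚ
    inv q with q ≟ 0ℚ
    ... | yes _  = 0ℚ
    ... | no q≢0 = (1/ q) {{≢-nonZero q≢0}}

    inv-inverse : ∀ {δ q} → 0ℚ < δ → δ ≤ ∣ q ∣ → q * inv q ≡ 1ℚ
    inv-inverse {δ} {q} 0<δ δ≤ with q ≟ 0ℚ
    ... | yes refl = contradiction (<-≤-trans 0<δ δ≤) (<-irrefl refl)
    ... | no q≢0   = *-inverseʳ q {{≢-nonZero q≢0}}

    inv-bound : ∀ {δ r q} → 0ℚ < δ → 0ℚ < r → δ * r ≡ 1ℚ → δ ≤ ∣ q ∣ → ∣ inv q ∣ ≤ r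
    inv-bound {δ} {r} {q} 0<δ 0<r δr≡1 δ≤ = begin
      ∣ inv q ∣             ≡⟨ *-identityʳ ∣ inv q ∣ ⟨
      ∣ inv q ∣ * 1ℚ        ≡⟨ ≡.cong (∣ inv q ∣ *_) δr≡1 ⟨
      ∣ inv q ∣ * (δ * r)
        ≤⟨ *-monoˡ (0≤∣p∣ (inv q)) (*-monoʳ-≤-nonNeg r {{nonNegative (<⇒≤ 0<r)}} δ≤) ⟩
      ∣ inv q ∣ * (∣ q ∣ * r) ≡⟨ lem (∣ inv q ∣) (∣ q ∣) r ⟩
      (∣ q ∣ * ∣ inv q ∣) * r ≡⟨ ≡.cong (_* r) (∣p*q∣≡∣p∣*∣q∣ q (inv q)) ⟨
      ∣ q * inv q ∣ * r     ≡⟨ ≡.cong (λ s → ∣ s ∣ * r) (inv-inverse 0<δ δ≤) ⟩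
      1ℚ * r                ≡⟨ *-identityˡ r ⟩
      r ∎
      where
      open ≤-Reasoning
      lem : ∀ a b c → a * (b * c) ≡ (b * a) * c
      lem = solve-∀ ℚ-ring

    inv-close : ∀ {δ r ε p q} → 0ℚ < δ → 0ℚ < r → δ * r ≡ 1ℚ → 0ℚ ≤ ε →
                δ ≤ ∣ p ∣ → δ ≤ ∣ q ∣ → ∣ q - p ∣ ≤ ε → ∣ inv p - inv q ∣ ≤ (r * r) * ε
    inv-close {δ} {r} {ε} {p} {q} 0<δ 0<r δr≡1 0≤ε δ≤p δ≤q q-p≤ε = begin
      ∣ inv p - inv q ∣
        ≡⟨ ≡.cong ∣_∣ (≡.cong₂ _-_ (*-identityˡ (inv p)) (*-identityˡ (inv q))) ⟨
      ∣ 1ℚ * inv p - 1ℚ * inv q ∣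
        ≡⟨ ≡.cong₂ (λ s t → ∣ s * inv p - t * inv q ∣)
             (inv-inverse 0<δ δ≤q) (inv-inverse 0<δ δ≤p) ⟨
      ∣ (q * inv q) * inv p - (p * inv p) * inv q ∣
        ≡⟨ ≡.cong ∣_∣ (lem p q (inv p) (inv q)) ⟩
      ∣ (inv p * inv q) * (q - p) ∣
        ≡⟨ ∣p*q∣≡∣p∣*∣q∣ (inv p * inv q) (q - p) ⟩
      ∣ inv p * inv q ∣ * ∣ q - p ∣
        ≡⟨ ≡.cong (_* ∣ q - p ∣) (∣p*q∣≡∣p∣*∣q∣ (inv p) (inv q)) ⟩
      (∣ inv p ∣ * ∣ inv q ∣) * ∣ q - p ∣
        ≤⟨ *-mono (∣ inv p ∣ * ∣ inv q ∣) (r * r) (∣ q - p ∣) ε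
             (≤-trans (0≤∣p∣ (inv p * inv q)) (≤-reflexive (∣p*q∣≡∣p∣*∣q∣ (inv p) (inv q))))
             0≤ε
             (*-mono (∣ inv p ∣) r (∣ inv q ∣) r (0≤∣p∣ (inv p)) (<⇒≤ 0<r)
               (inv-bound 0<δ 0<r δr≡1 δ≤p) (inv-bound 0<δ 0<r δr≡1 δ≤q))
             q-p≤ε ⟩
      (r * r) * ε ∎
      where
      open ≤-Reasoning
      lem : ∀ p q u v → (q * v) * u - (p * u) * v ≡ (u * v) * (q - p)
      lem = solve-∀ ℚ-ring

    inv-~ : ∀ x → x #0 → (λ n → inv (seq x n)) ~ (λ n → inv (seq x n))
    inv-~ x (mk# 0<δ J b) =
      let r , 0<r , δr≡1 = recip 0<δ
      in scaled (0<* 0<r 0<r) λ {ε} 0<ε →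
      let N , h = within (cauchy x) 0<ε
      in J ℕ.⊔ N , λ {m} {n} ≤m ≤n →
      inv-close {p = seq x m} {q = seq x n} 0<δ 0<r δr≡1 (<⇒≤ 0<ε)
        (b (ℕ.m⊔n≤o⇒m≤o J N ≤m)) (b (ℕ.m⊔n≤o⇒m≤o J N ≤n))
        (<⇒≤ (h (ℕ.m⊔n≤o⇒n≤o J N ≤n) (ℕ.m⊔n≤o⇒n≤o J N ≤m)))

  opaque
    unfolding fromℚ

    _⁻¹ʳ : (x : ℝ) {{_ : x #0}} → ℝ
    (x ⁻¹ʳ) {{x#0}} = mkℝ (λ n → inv (seq x n)) (inv-~ x x#0)

    *-⁻¹ʳ : ∀ x {{_ : x #0}} → x *ʳ (x ⁻¹ʳ) ≃ fromℚ 1ℚ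
    *-⁻¹ʳ x {{x#0@(mk# 0<δ J b)}} = mk≃ (mk~ λ 0<ε → J , λ {m} J≤m _ →
      ≤-<-trans (≤-reflexive (≡.cong (λ s → ∣ s - 1ℚ ∣) (inv-inverse 0<δ (b J≤m)))) 0<ε)

    sumOfSquares#0 : ∀ {x y} → x #0 ⊎ y #0 → x *ʳ x +ʳ y *ʳ y #0
    sumOfSquares#0 {x} {y} = λ where
        (inj₁ (mk# 0<δ J b)) → mk# (0<* 0<δ 0<δ) J λ {n} J≤n →
          ≤-trans (squares (<⇒≤ 0<δ) (seq x n) (seq y n) (b J≤n)) (p≤∣p∣ _)
        (inj₂ (mk# 0<δ J b)) → mk# (0<* 0<δ 0<δ) J λ {n} J≤n →
          ≤-trans (≤-trans (squares (<⇒≤ 0<δ) (seq y n) (seq x n) (b J≤n))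
                           (≤-reflexive (+-comm (seq y n * seq y n) _)))
                  (p≤∣p∣ _)
      where
      squares : ∀ {δ} → 0ℚ ≤ δ → ∀ p q → δ ≤ ∣ p ∣ → δ * δ ≤ p * p + q * q
      squares {δ} 0≤δ p q δ≤ = begin
        δ * δ           ≤⟨ *-mono δ (∣ p ∣) δ (∣ p ∣) 0≤δ (0≤∣p∣ p) δ≤ δ≤ ⟩
        ∣ p ∣ * ∣ p ∣   ≡⟨ ∣p*q∣≡∣p∣*∣q∣ p p ⟨
        ∣ p * p ∣       ≡⟨ 0≤p⇒∣p∣≡p (0≤p*p p) ⟩
        p * p           ≡⟨ +-identityʳ (p * p) ⟨
        p * p + 0ℚ      ≤⟨ +-monoʳ-≤ (p * p) (0≤p*p q) ⟩
        p * p + q * q   ∎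
        where open ≤-Reasoning

  private
    2ℚ : ℚ
    2ℚ = 1ℚ + 1ℚ

    half^ : ℕ → ℚ
    half^ zero    = 1ℚ
    half^ (suc n) = ½ * half^ n

    bisect : ℚ → ℚ → ℚ
    bisect a h = if does ((a + h) * (a + h) ≤? 2ℚ) then a + h else a

    -- √2-approx n ≤ √2 < √2-approx n + half^ n.
    √2-approx : ℕ → ℚ
    √2-approx zero    = 1ℚ
    √2-approx (suc n) = bisect (√2-approx n) (half^ (suc n))

    half+half : ∀ h → ½ * h + ½ * h ≡ h
    half+half h = ≡.trans (≡.sym (*-distribʳ-+ h ½ ½)) (*-identityˡ h)

    0<half^ : ∀ n → 0ℚ < half^ n
    0<half^ zero    = 0<1
    0<half^ (suc n) = 0<* (positive⁻¹ ½) (0<half^ n)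

    half^≤1 : ∀ n → half^ n ≤ 1ℚ
    half^≤1 zero    = ≤-refl
    half^≤1 (suc n) = begin
      ½ * half^ n                 ≡⟨ +-identityʳ (½ * half^ n) ⟨
      ½ * half^ n + 0ℚ            ≤⟨ +-monoʳ-≤ (½ * half^ n) (<⇒≤ (0<half^ (suc n))) ⟩
      ½ * half^ n + ½ * half^ n   ≡⟨ half+half (half^ n) ⟩
      half^ n                     ≤⟨ half^≤1 n ⟩
      1ℚ                          ∎
      where open ≤-Reasoning

    ι : ℕ → ℚ
    ι zero    = 0ℚ
    ι (suc n) = 1ℚ + ι n

    0≤ι : ∀ n → 0ℚ ≤ ι n
    0≤ι zero    = ≤-refl
    0≤ι (suc n) = +-mono-≤ (<⇒≤ 0<1) (0≤ι n)

    ι-mono : ∀ {m n} → m ℕ.≤ n → ι m ≤ ι n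
    ι-mono {n = n} ℕ.z≤n = 0≤ι n
    ι-mono (ℕ.s≤s m≤n)   = +-monoʳ-≤ 1ℚ (ι-mono m≤n)

    half^*ι≤1 : ∀ n → half^ n * ι (suc n) ≤ 1ℚ
    half^*ι≤1 zero    = ≤-refl
    half^*ι≤1 (suc n) = begin
      (½ * h) * (1ℚ + (1ℚ + i))       ≡⟨ lem ½ h i ⟩
      ½ * h + ½ * (h * (1ℚ + i))      ≤⟨ +-mono-≤ ½h≤½ (*-monoˡ 0≤½ (half^*ι≤1 n)) ⟩
      ½ * 1ℚ + ½ * 1ℚ                 ≡⟨ half+half 1ℚ ⟩
      1ℚ                              ∎
      where
      open ≤-Reasoning
      h = half^ n
      i = ι n
      0≤½ = nonNegative⁻¹ ½
      ½h≤½ = *-monoˡ 0≤½ (half^≤1 n)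
      lem : ∀ s h i → (s * h) * (1ℚ + (1ℚ + i)) ≡ s * h + s * (h * (1ℚ + i))
      lem = solve-∀ ℚ-ring

    toℚᵘ-ι : ∀ n → toℚᵘ (ι n) ℚᵘ.≃ ℚᵘ.mkℚᵘ (+ n) 0
    toℚᵘ-ι zero    = ℚᵘ.≃-refl
    toℚᵘ-ι (suc n) = ℚᵘ.≃-trans (toℚᵘ-homo-+ 1ℚ (ι n))
      (ℚᵘ.≃-trans (ℚᵘ.+-congʳ ℚᵘ.1ℚᵘ (toℚᵘ-ι n))
        (ℚᵘ.*≡* (≡.cong (λ k → (+ 1 ℤ.+ k) ℤ.* + 1) (ℤ.*-identityʳ (+ n)))))

    archimedean : ∀ {ε} → 0ℚ < ε → ∃ λ N → 1ℚ ≤ ι N * ε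
    archimedean {ε} 0<ε = go ε {{positive 0<ε}}
      where
      open ℚᵘ.≤-Reasoning
      go : ∀ ε → .{{Positive ε}} → ∃ λ N → 1ℚ ≤ ι N * ε
      go ε@(mkℚ +[1+ p ] q _) = suc q , toℚᵘ-cancel-≤ (begin
        ℚᵘ.1ℚᵘ                                  ≤⟨ ℚᵘ.*≤* (ℤ.+≤+ le) ⟩
        ℚᵘ.mkℚᵘ (+ suc q) 0 ℚᵘ.* toℚᵘ ε         ≃⟨ ℚᵘ.*-congʳ {toℚᵘ ε} (toℚᵘ-ι (suc q)) ⟨
        toℚᵘ (ι (suc q)) ℚᵘ.* toℚᵘ ε            ≃⟨ toℚᵘ-homo-* (ι (suc q)) ε ⟨
        toℚᵘ (ι (suc q) * ε)                    ∎)
        where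
        le : 1 ℕ.* (1 ℕ.* suc q) ℕ.≤ suc q ℕ.* suc p ℕ.* 1
        le rewrite ℕ.*-identityˡ (1 ℕ.* suc q) | ℕ.*-identityˡ (suc q)
                 | ℕ.*-identityʳ (suc q ℕ.* suc p) = ℕ.m≤m*n (suc q) (suc p)

    half^-small : ∀ {ε} → 0ℚ < ε → ∃ λ N → ∀ {n} → N ℕ.≤ n → half^ n < ε
    half^-small {ε} 0<ε =
      let N , 1≤Nε = archimedean 0<ε
      in N , λ {n} N≤n → ≰⇒> λ ε≤h → <-irrefl refl (begin-strict
        1ℚ                    ≤⟨ 1≤Nε ⟩
        ι N * ε               ≤⟨ *-mono (ι N) (ι n) ε (half^ n) (0≤ι N) (<⇒≤ (0<half^ n)) (ι-mono N≤n) ε≤h ⟩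
        ι n * half^ n         <⟨ lem n ⟩
        half^ n * ι (suc n)   ≤⟨ half^*ι≤1 n ⟩
        1ℚ                    ∎)
      where
      open ≤-Reasoning
      eq₁ : ∀ i h → i * h ≡ 0ℚ + h * i
      eq₁ = solve-∀ ℚ-ring
      eq₂ : ∀ i h → h * (1ℚ + i) ≡ h + h * i
      eq₂ = solve-∀ ℚ-ring
      lem : ∀ n → ι n * half^ n < half^ n * ι (suc n)
      lem n = begin-strict
        ι n * half^ n             ≡⟨ eq₁ (ι n) (half^ n) ⟩
        0ℚ + half^ n * ι n        <⟨ +-monoˡ-< (half^ n * ι n) (0<half^ n) ⟩
        half^ n + half^ n * ι n   ≡⟨ eq₂ (ι n) (half^ n) ⟨
        half^ n * ι (suc n)       ∎

    record Bracket (a h : ℚ) : Set where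
      constructor bracket
      field
        1≤a   : 1ℚ ≤ a
        a²≤2  : a * a ≤ 2ℚ
        2<    : 2ℚ < (a + h) * (a + h)

    open Bracket

    bisect-bracket : ∀ a h → 0ℚ < h → Bracket a (h + h) → Bracket (bisect a h) h
    bisect-bracket a h 0<h (bracket 1≤a a²≤2 2<) = go ((a + h) * (a + h) ≤? 2ℚ)
      where
      go : (d : Dec ((a + h) * (a + h) ≤ 2ℚ)) → Bracket (if does d then a + h else a) h
      go (yes le) = bracket
        (≤-trans 1≤a (≤-trans (≤-reflexive (≡.sym (+-identityʳ a))) (+-monoʳ-≤ a (<⇒≤ 0<h))))
        le
        (<-≤-trans 2< (≤-reflexive (≡.cong (λ s → s * s) (≡.sym (+-assoc a h h)))))
      go (no ≰) = bracket 1≤a a²≤2 (≰⇒> ≰)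

    √2-bracket : ∀ n → Bracket (√2-approx n) (half^ n)
    √2-bracket zero    = bracket ≤-refl (*≤* (ℤ.+≤+ (ℕ.s≤s ℕ.z≤n)))
      (*<* (ℤ.+<+ (ℕ.s≤s (ℕ.s≤s (ℕ.s≤s ℕ.z≤n)))))
    √2-bracket (suc n) = bisect-bracket (√2-approx n) (half^ (suc n)) (0<half^ (suc n))
      (≡.subst (Bracket (√2-approx n)) (≡.sym (half+half (half^ n))) (√2-bracket n))

    bracket-< : ∀ {a b h k} → 0ℚ < k → Bracket a h → Bracket b k → a < b + k
    bracket-< {a} {b} {h} {k} 0<k A B = ≰⇒> λ b+k≤a → <-irrefl refl
      (<-≤-trans (2< B) (≤-trans
        (*-mono (b + k) a (b + k) a 0≤b+k 0≤a b+k≤a b+k≤a)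
        (a²≤2 A)))
      where
      0≤a   = ≤-trans (<⇒≤ 0<1) (1≤a A)
      0≤b+k = +-mono-≤ (≤-trans (<⇒≤ 0<1) (1≤a B)) (<⇒≤ 0<k)

    √2-cauchy : √2-approx ~ √2-approx
    √2-cauchy .within {ε} 0<ε =
      let N , h = half^-small 0<ε
      in N , λ {m} {n} N≤m N≤n → ∣p-q∣<r {√2-approx m} {√2-approx n}
        (<-trans (bracket-< (0<half^ n) (√2-bracket m) (√2-bracket n)) (+-monoʳ-< (√2-approx n) (h N≤n)))
        (<-trans (bracket-< (0<half^ m) (√2-bracket n) (√2-bracket m)) (+-monoʳ-< (√2-approx m) (h N≤m)))

  private
    5ℚ : ℚ
    5ℚ = 2ℚ + 2ℚ + 1ℚ

    square : ∀ a h → (a + h) * (a + h) ≡ a * a + (a + a + h) * h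
    square = solve-∀ ℚ-ring

    √2-error : ∀ {a h} → 0ℚ < h → h ≤ 1ℚ → Bracket a h → ∣ a * a - 2ℚ ∣ < 5ℚ * h
    √2-error {a} {h} 0<h h≤1 (bracket 1≤a a²≤2 2<) = ∣p-q∣<r {a * a} {2ℚ}
      (≤-<-trans a²≤2 (≤-<-trans (≤-reflexive (≡.sym (+-identityʳ 2ℚ)))
        (+-monoʳ-< 2ℚ (0<* (positive⁻¹ 5ℚ) 0<h))))
      (<-≤-trans 2< (≤-trans (≤-reflexive (square a h))
        (+-monoʳ-≤ (a * a) (*-monoʳ-≤-nonNeg h {{nonNegative (<⇒≤ 0<h)}}
          (+-mono-≤ (+-mono-≤ a≤2 a≤2) h≤1)))))
      where
      a≤2 : a ≤ 2ℚ
      a≤2 = ≤-trans (≤-reflexive (≡.sym (*-identityˡ a)))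
        (≤-trans (*-monoʳ-≤-nonNeg a {{nonNegative (≤-trans (<⇒≤ 0<1) 1≤a)}} 1≤a) a²≤2)

  1≤-#0 : ∀ {x} → (∀ n → 1ℚ ≤ seq x n) → x #0
  1≤-#0 {x} 1≤ = mk# 0<1 0 λ {n} _ → ≤-trans (1≤ n) (p≤∣p∣ (seq x n))

  opaque
    unfolding fromℚ

    √2 : ℝ
    √2 = mkℝ √2-approx √2-cauchy

    1≤√2 : ∀ n → 1ℚ ≤ seq √2 n
    1≤√2 n = 1≤a (√2-bracket n)

    √2#0 : √2 #0
    √2#0 = 1≤-#0 1≤√2

    √2*√2 : √2 *ʳ √2 ≃ fromℚ 1ℚ +ʳ fromℚ 1ℚ
    √2*√2 = mk≃ (scaled {K = 5ℚ} (positive⁻¹ 5ℚ) λ {δ} 0<δ →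
      let N , h = half^-small 0<δ
      in N , λ {m} N≤m _ → <⇒≤ (<-≤-trans
           (√2-error (0<half^ m) (half^≤1 m) (√2-bracket m))
           (*-monoˡ (nonNegative⁻¹ 5ℚ) (<⇒≤ (h N≤m)))))

------------------------------------------------------------------------
-- R[X] / (X² - s) for a commutative ring R and s ∈ R

module AdjoinRoot {c ℓ} (R : CommutativeRing c ℓ) (s : CommutativeRing.Carrier R) where

  private
    module R = CommutativeRing R
    open R using (_+_; _*_; _≈_; 0#)

  -- a +√ b is the class of a + b X.
  record Carrier : Set c where
    constructor _+√_
    field
      re im : R.Carrier

  open Carrier

  infix 4 _≋_

  record _≋_ (z w : Carrier) : Set ℓ where
    constructor _,_
    field
      re≈ : re z ≈ re w
      im≈ : im z ≈ im w

  private
    _⊕_ _⊗_ : Carrier → Carrier → Carrier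
    (a +√ b) ⊕ (c +√ d) = (a + c) +√ (b + d)
    (a +√ b) ⊗ (c +√ d) = (a * c + s * (b * d)) +√ (a * d + b * c)

    ⊖_ : Carrier → Carrier
    ⊖ (a +√ b) = (R.- a) +√ (R.- b)

    open import Algebra.Solver.Ring.NaturalCoefficients.Default R.commutativeSemiring

    assoc-re : ∀ a b c d e f →
      (a * c + s * (b * d)) * e + s * ((a * d + b * c) * f) ≈
      a * (c * e + s * (d * f)) + s * (b * (c * f + d * e))
    assoc-re = solve 7 (λ s a b c d e f →
      (a :* c :+ s :* (b :* d)) :* e :+ s :* ((a :* d :+ b :* c) :* f) :=
      a :* (c :* e :+ s :* (d :* f)) :+ s :* (b :* (c :* f :+ d :* e))) R.refl s

    assoc-im : ∀ a b c d e f →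
      (a * c + s * (b * d)) * f + (a * d + b * c) * e ≈
      a * (c * f + d * e) + b * (c * e + s * (d * f))
    assoc-im = solve 7 (λ s a b c d e f →
      (a :* c :+ s :* (b :* d)) :* f :+ (a :* d :+ b :* c) :* e :=
      a :* (c :* f :+ d :* e) :+ b :* (c :* e :+ s :* (d :* f))) R.refl s

    distribˡ-re : ∀ a b c d e f →
      a * (c + e) + s * (b * (d + f)) ≈
      (a * c + s * (b * d)) + (a * e + s * (b * f))
    distribˡ-re = solve 7 (λ s a b c d e f →
      a :* (c :+ e) :+ s :* (b :* (d :+ f)) :=
      (a :* c :+ s :* (b :* d)) :+ (a :* e :+ s :* (b :* f))) R.refl s

    distribˡ-im : ∀ a b c d e f →
      a * (d + f) + b * (c + e) ≈
      (a * d + b * c) + (a * f + b * e)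
    distribˡ-im = solve 7 (λ s a b c d e f →
      a :* (d :+ f) :+ b :* (c :+ e) :=
      (a :* d :+ b :* c) :+ (a :* f :+ b :* e)) R.refl s

    comm-re : ∀ a b c d → a * c + s * (b * d) ≈ c * a + s * (d * b)
    comm-re = solve 5 (λ s a b c d → a :* c :+ s :* (b :* d) := c :* a :+ s :* (d :* b)) R.refl s

    comm-im : ∀ a b c d → a * d + b * c ≈ c * b + d * a
    comm-im = solve 5 (λ s a b c d → a :* d :+ b :* c := c :* b :+ d :* a) R.refl s

    ⊗-comm : ∀ z w → z ⊗ w ≋ w ⊗ z
    ⊗-comm (a +√ b) (c +√ d) = comm-re a b c d , comm-im a b c d

    ⊗-identityˡ : ∀ z → (R.1# +√ 0#) ⊗ z ≋ z
    ⊗-identityˡ (a +√ b) =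
      R.trans (R.+-cong (R.*-identityˡ a) (R.trans (R.*-congˡ (R.zeroˡ b)) (R.zeroʳ s))) (R.+-identityʳ a) ,
      R.trans (R.+-cong (R.*-identityˡ b) (R.zeroˡ a)) (R.+-identityʳ b)

    ⊗-distribˡ-⊕ : ∀ z w v → z ⊗ (w ⊕ v) ≋ (z ⊗ w) ⊕ (z ⊗ v)
    ⊗-distribˡ-⊕ (a +√ b) (c +√ d) (e +√ f) = distribˡ-re a b c d e f , distribˡ-im a b c d e f

    ≋-trans : ∀ {z w v} → z ≋ w → w ≋ v → z ≋ v
    ≋-trans (p , q) (r , s) = R.trans p r , R.trans q s

    ⊕-cong : ∀ {z z′ w w′} → z ≋ z′ → w ≋ w′ → z ⊕ w ≋ z′ ⊕ w′
    ⊕-cong (p , q) (r , s) = R.+-cong p r , R.+-cong q s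

  commutativeRing : CommutativeRing c ℓ
  commutativeRing = record
    { Carrier = Carrier ; _≈_ = _≋_ ; _+_ = _⊕_ ; _*_ = _⊗_ ; -_ = ⊖_
    ; 0# = 0# +√ 0# ; 1# = R.1# +√ 0#
    ; isCommutativeRing = record
      { isRing = record
        { +-isAbelianGroup = record
          { isGroup = record
            { isMonoid = record
              { isSemigroup = record
                { isMagma = record
                  { isEquivalence = record
                    { refl  = R.refl , R.refl
                    ; sym   = λ { (p , q) → R.sym p , R.sym q }
                    ; trans = ≋-trans
                    }
                  ; ∙-cong = ⊕-cong
                  }
                ; assoc = λ { (a +√ b) (c +√ d) (e +√ f) → R.+-assoc a c e , R.+-assoc b d f }
                }
              ; identity = (λ { (a +√ b) → R.+-identityˡ a , R.+-identityˡ b })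
                         , (λ { (a +√ b) → R.+-identityʳ a , R.+-identityʳ b })
              }
            ; inverse = (λ { (a +√ b) → R.-‿inverseˡ a , R.-‿inverseˡ b })
                      , (λ { (a +√ b) → R.-‿inverseʳ a , R.-‿inverseʳ b })
            ; ⁻¹-cong = λ { (p , q) → R.-‿cong p , R.-‿cong q }
            }
          ; comm = λ { (a +√ b) (c +√ d) → R.+-comm a c , R.+-comm b d }
          }
        ; *-cong = λ { (p , q) (r , s) →
            R.+-cong (R.*-cong p r) (R.*-congˡ (R.*-cong q s)) ,
            R.+-cong (R.*-cong p s) (R.*-cong q r) }
        ; *-assoc = λ { (a +√ b) (c +√ d) (e +√ f) →
            assoc-re a b c d e f , assoc-im a b c d e f }
        ; *-identity = ⊗-identityˡ
                     , (λ z → ≋-trans (⊗-comm z (R.1# +√ 0#)) (⊗-identityˡ z))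
        ; distrib = ⊗-distribˡ-⊕
                  , (λ z w v → ≋-trans (⊗-comm (w ⊕ v) z)
                       (≋-trans (⊗-distribˡ-⊕ z w v) (⊕-cong (⊗-comm z w) (⊗-comm z v))))
        }
      ; *-comm = ⊗-comm
      }
    }

------------------------------------------------------------------------
-- Complex numbers

module ComplexNumbers where

  open import Data.Rational as ℚ using (0ℚ; 1ℚ)
  import Data.Rational.Properties as ℚ
  open Reals using (ℝ; module ℝ; ℝ-commutativeRing)
  open ℝ using (seq)
  private module R = CommutativeRing ℝ-commutativeRing

  open AdjoinRoot ℝ-commutativeRing (R.- R.1#) public
    using (_+√_; _,_)
    renaming (Carrier to ℂ; module Carrier to ℂ; commutativeRing to ℂ-commutativeRing)
  open ℂ

  open CommutativeRing ℂ-commutativeRing public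
    using (_≈_; _+_; _*_; -_; _-_; 0#; 1#)
  open import Algebra.Definitions.RawSemiring
    (Semiring.rawSemiring (CommutativeRing.semiring ℂ-commutativeRing)) public
    using (_^_; sum; product)
    renaming (_×_ to infixr 8 _·_)

  infix 4 _#0

  -- Apartness from zero, the constructive form of z ≠ 0.
  data _#0 : ℂ → Set where
    re#0 : ∀ {a b} → a Reals.#0 → a +√ b #0
    im#0 : ∀ {a b} → b Reals.#0 → a +√ b #0

  ∣_∣² : ℂ → ℝ
  ∣ a +√ b ∣² = a R.* a R.+ b R.* b

  ∣z∣²#0 : ∀ {z} → z #0 → ∣ z ∣² Reals.#0
  ∣z∣²#0 (re#0 a#0) = Reals.sumOfSquares#0 (inj₁ a#0)
  ∣z∣²#0 (im#0 b#0) = Reals.sumOfSquares#0 (inj₂ b#0)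

  inverse : (z : ℂ) → z #0 → ℂ
  inverse z@(a +√ b) z#0 = (a R.* r) +√ (R.- b R.* r)
    where r = (∣ z ∣² Reals.⁻¹ʳ) {{∣z∣²#0 z#0}}

  *-inverse : ∀ z (z#0 : z #0) → z * inverse z z#0 ≈ 1#
  *-inverse z@(a +√ b) z#0 =
    R.trans re-lem (Reals.*-⁻¹ʳ ∣ z ∣² {{∣z∣²#0 z#0}}) , im-lem
    where
    r = (∣ z ∣² Reals.⁻¹ʳ) {{∣z∣²#0 z#0}}
    open import Relation.Binary.Reasoning.Setoid R.setoid
    open import Algebra.Properties.Ring R.ring using (-1*x≈-x; -‿distribˡ-*; -‿distribʳ-*)
    open import Algebra.Properties.Group R.+-group using (⁻¹-involutive)
    re-lem : a R.* (a R.* r) R.+ R.- R.1# R.* (b R.* (R.- b R.* r)) R.≈ (a R.* a R.+ b R.* b) R.* r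
    re-lem = begin
      a R.* (a R.* r) R.+ R.- R.1# R.* (b R.* (R.- b R.* r))
        ≈⟨ R.+-cong (R.sym (R.*-assoc a a r)) (-1*x≈-x (b R.* (R.- b R.* r))) ⟩
      a R.* a R.* r R.+ R.- (b R.* (R.- b R.* r))
        ≈⟨ R.+-congˡ (-‿distribʳ-* b (R.- b R.* r)) ⟩
      a R.* a R.* r R.+ b R.* (R.- (R.- b R.* r))
        ≈⟨ R.+-congˡ (R.*-congˡ (-‿distribˡ-* (R.- b) r)) ⟩
      a R.* a R.* r R.+ b R.* (R.- (R.- b) R.* r)
        ≈⟨ R.+-congˡ (R.*-congˡ (R.*-congʳ (⁻¹-involutive b))) ⟩
      a R.* a R.* r R.+ b R.* (b R.* r)
        ≈⟨ R.+-congˡ (R.sym (R.*-assoc b b r)) ⟩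
      a R.* a R.* r R.+ b R.* b R.* r
        ≈⟨ R.distribʳ r (a R.* a) (b R.* b) ⟨
      (a R.* a R.+ b R.* b) R.* r ∎
    im-lem : a R.* (R.- b R.* r) R.+ b R.* (a R.* r) R.≈ R.0#
    im-lem = begin
      a R.* (R.- b R.* r) R.+ b R.* (a R.* r)
        ≈⟨ R.+-cong (R.sym (R.*-assoc a (R.- b) r)) (R.sym (R.*-assoc b a r)) ⟩
      a R.* R.- b R.* r R.+ b R.* a R.* r
        ≈⟨ R.+-cong (R.*-congʳ (R.sym (-‿distribʳ-* a b))) (R.*-congʳ (R.*-comm b a)) ⟩
      R.- (a R.* b) R.* r R.+ a R.* b R.* r
        ≈⟨ R.distribʳ r (R.- (a R.* b)) (a R.* b) ⟨
      (R.- (a R.* b) R.+ a R.* b) R.* r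
        ≈⟨ R.*-congʳ (R.-‿inverseˡ (a R.* b)) ⟩
      R.0# R.* r
        ≈⟨ R.zeroˡ r ⟩
      R.0# ∎

  infixl 7 _÷_by_

  _÷_by_ : ℂ → (w : ℂ) → w #0 → ℂ
  z ÷ w by w#0 = z * inverse w w#0

  fromℕ : ℕ → ℂ
  fromℕ n = n · 1#

  opaque
    unfolding Reals.fromℚ

    fromℕ-#0 : ∀ n .{{_ : ℕ.NonZero n}} → fromℕ n #0
    fromℕ-#0 (suc n) = re#0 (Reals.1≤-#0 λ k → ℚ.+-mono-≤ (ℚ.≤-refl {1ℚ}) (0≤ n k))
      where
      0≤ : ∀ n k → 0ℚ ℚ.≤ seq (re (fromℕ n)) k
      0≤ zero    k = ℚ.≤-refl
      0≤ (suc n) k = ℚ.+-mono-≤ (ℚ.nonNegative⁻¹ 1ℚ) (0≤ n k)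

  √2 ½ : ℂ
  √2 = Reals.√2 +√ Reals.fromℚ 0ℚ
  ½  = Reals.fromℚ ℚ.½ +√ Reals.fromℚ 0ℚ

  ½+½≈1 : ½ + ½ ≈ 1#
  ½+½≈1 = Reals.½+½ʳ , R.+-identityʳ R.0#

  √2*√2≈2 : √2 * √2 ≈ 1# + 1#
  √2*√2≈2 =
    R.trans (R.+-cong Reals.√2*√2 (R.trans (R.*-congˡ (R.zeroʳ R.0#)) (R.zeroʳ (R.- R.1#))))
            (R.+-identityʳ (R.1# R.+ R.1#)) ,
    R.+-cong (R.zeroʳ Reals.√2) (R.zeroˡ Reals.√2)

  √2#0 : √2 #0
  √2#0 = re#0 Reals.√2#0

open ComplexNumbers public

------------------------------------------------------------------------
-- Binary linear codes

module _ where

  open import Data.Fin.Base using (Fin)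
  open import Data.Fin.Properties using (_≟_)
  open import Data.Fin.Subset using (Subset; ∣_∣)
  open import Data.Fin.Subset.Properties using (_∈?_)
  open import Data.List.Base using (List; []; _∷_; cartesianProductWith; filter; foldr; length)
  open import Data.List.Membership.Propositional using (_∈_)
  open import Data.List.Membership.Propositional.Properties
    using (∈-cartesianProductWith⁺; ∈-filter⁺; ∈-filter⁻; ∈-length)
  import Data.List.Relation.Unary.All as All
  open import Data.List.Relation.Unary.Any using (here; there)
  open import Data.Parity.Base as ℙ using (0ℙ; 1ℙ) renaming (Parity to F₂)
  import Data.Parity.Properties as ℙ
  open import Data.Vec.Base as Vec using (Vec; []; _∷_; count; foldr′; lookup; replicate; zipWith)
  open import Relation.Unary using (Decidable)

  F₂^ : ℕ → Set
  F₂^ = Vec F₂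

  allVectors : ∀ n → List (F₂^ n)
  allVectors zero    = [] ∷ []
  allVectors (suc n) = cartesianProductWith _∷_ (0ℙ ∷ 1ℙ ∷ []) (allVectors n)

  ∈-allVectors : ∀ {n} (v : F₂^ n) → v ∈ allVectors n
  ∈-allVectors []       = here refl
  ∈-allVectors (0ℙ ∷ v) =
    ∈-cartesianProductWith⁺ _∷_ {xs = 0ℙ ∷ 1ℙ ∷ []} (here refl) (∈-allVectors v)
  ∈-allVectors (1ℙ ∷ v) =
    ∈-cartesianProductWith⁺ _∷_ {xs = 0ℙ ∷ 1ℙ ∷ []} (there (here refl)) (∈-allVectors v)

  wt : ∀ {n} → F₂^ n → ℕ
  wt = count (λ a → ¬? (a ℙ.≟ 0ℙ))

  ⟨_,_⟩ : ∀ {n} → F₂^ n → F₂^ n → F₂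
  ⟨ v , w ⟩ = foldr′ ℙ._+_ 0ℙ (zipWith ℙ._*_ v w)

  -- Membership is required to be decidable so that the finite sum over C and
  -- the cardinality of C can be formed; classically this is no restriction.
  record Code (n : ℕ) : Set₁ where
    field
      Member   : F₂^ n → Set
      member?  : Decidable Member
      0-closed : Member (replicate n 0ℙ)
      +-closed : ∀ {v w} → Member v → Member w → Member (zipWith ℙ._+_ v w)
      *-closed : ∀ a {v} → Member v → Member (Vec.map (a ℙ.*_) v)

    codewords : List (F₂^ n)
    codewords = filter member? (allVectors n)

    size : ℕ
    size = length codewords

    size-nonZero : ℕ.NonZero size
    size-nonZero = ℕ.>-nonZero (∈-length (∈-filter⁺ member? (∈-allVectors _) 0-closed))

  open Code

  size#0 : ∀ {n} (C : Code n) → fromℕ (size C) #0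
  size#0 C = fromℕ-#0 (size C) {{size-nonZero C}}

  ⟨0,w⟩≡0 : ∀ {n} (w : F₂^ n) → ⟨ replicate n 0ℙ , w ⟩ ≡ 0ℙ
  ⟨0,w⟩≡0 []      = refl
  ⟨0,w⟩≡0 (a ∷ w) = ⟨0,w⟩≡0 w

  ⟨u+v,w⟩ : ∀ {n} (u v w : F₂^ n) → ⟨ zipWith ℙ._+_ u v , w ⟩ ≡ ⟨ u , w ⟩ ℙ.+ ⟨ v , w ⟩
  ⟨u+v,w⟩ []      []      []      = refl
  ⟨u+v,w⟩ (a ∷ u) (b ∷ v) (c ∷ w) = begin
    ((a ℙ.+ b) ℙ.* c) ℙ.+ ⟨ zipWith ℙ._+_ u v , w ⟩
      ≡⟨ ≡.cong₂ ℙ._+_ (ℙ.*-distribʳ-+ c a b) (⟨u+v,w⟩ u v w) ⟩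
    ((a ℙ.* c) ℙ.+ (b ℙ.* c)) ℙ.+ (⟨ u , w ⟩ ℙ.+ ⟨ v , w ⟩)
      ≡⟨ interchange (a ℙ.* c) (b ℙ.* c) ⟨ u , w ⟩ ⟨ v , w ⟩ ⟩
    ((a ℙ.* c) ℙ.+ ⟨ u , w ⟩) ℙ.+ ((b ℙ.* c) ℙ.+ ⟨ v , w ⟩) ∎
    where
    open ≡.≡-Reasoning
    open import Algebra.Properties.CommutativeSemigroup
      (CommutativeRing.+-commutativeSemigroup ℙ.+-*-commutativeRing) using (interchange)

  ⟨av,w⟩ : ∀ {n} a (v w : F₂^ n) → ⟨ Vec.map (a ℙ.*_) v , w ⟩ ≡ a ℙ.* ⟨ v , w ⟩
  ⟨av,w⟩ a  []      []      = ≡.sym (ℙ.*-zeroʳ a)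
  ⟨av,w⟩ 0ℙ (b ∷ v) (c ∷ w) = ⟨av,w⟩ 0ℙ v w
  ⟨av,w⟩ 1ℙ (b ∷ v) (c ∷ w) = ≡.cong ((b ℙ.* c) ℙ.+_) (⟨av,w⟩ 1ℙ v w)

  infix 9 _⊥

  _⊥ : ∀ {n} → Code n → Code n
  _⊥ {n} C = record
    { Member   = λ v → ∀ {c} → Member C c → ⟨ v , c ⟩ ≡ 0ℙ
    ; member?  = λ v → map′
        (λ all c∈C → All.lookup all (∈-filter⁺ (member? C) (∈-allVectors _) c∈C))
        (λ v⊥C → All.tabulate λ c∈ →
          v⊥C (proj₂ (∈-filter⁻ (member? C) {xs = allVectors n} c∈)))
        (All.all? (λ c → ⟨ v , c ⟩ ℙ.≟ 0ℙ) (codewords C))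
    ; 0-closed = λ {c} _ → ⟨0,w⟩≡0 c
    ; +-closed = λ {u} {v} u⊥C v⊥C {c} c∈C →
        ≡.trans (⟨u+v,w⟩ u v c) (≡.cong₂ ℙ._+_ (u⊥C c∈C) (v⊥C c∈C))
    ; *-closed = λ a {v} v⊥C {c} c∈C →
        ≡.trans (⟨av,w⟩ a v c) (≡.trans (≡.cong (a ℙ.*_) (v⊥C c∈C)) (ℙ.*-zeroʳ a))
    }

  ------------------------------------------------------------------------
  -- Discrete harmonic polynomials

  infix 5 sumOver sumFin productFin

  sumOver : {A : Set} → List A → (A → ℂ) → ℂ
  sumOver xs f = foldr (λ a s → f a + s) 0# xs

  sumFin productFin : ∀ n → (Fin n → ℂ) → ℂ
  sumFin _ = sum
  productFin _ = product

  syntax sumOver xs (λ a → e) = Σ[ a ∈ xs ] e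
  syntax sumFin n (λ j → e) = Σ[ j < n ] e
  syntax productFin n (λ j → e) = Π[ j < n ] e

  weightEnumerator : ∀ {n} → Code n → (F₂^ n → ℂ) → ℂ → ℂ → ℂ
  weightEnumerator {n} C Q x y =
    Σ[ c ∈ codewords C ] (Q c * x ^ (n ℕ.∸ wt c) * y ^ wt c)

  -- sgn a = (-1)ᵃ
  sgn : F₂ → ℂ
  sgn 0ℙ = 1#
  sgn 1ℙ = - 1#

  χ : ∀ {n} → Subset n → F₂^ n → ℂ
  χ {n} J v = Π[ j < n ] (if does (j ∈? J) then sgn (lookup v j) else 1#)

  infix 4 _∈𝒟_ _∈𝒟⁰_

  record _∈𝒟_ {n : ℕ} (Q : F₂^ n → ℂ) (d : ℕ) : Set where
    field
      terms       : ℕ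
      coefficient : Fin terms → ℂ
      index       : Fin terms → Subset n
      degree      : ∀ i → ∣ index i ∣ ≡ d
      combination : ∀ v → Q v ≈ Σ[ i < terms ] (coefficient i * χ (index i) v)

  Matrix : Set
  Matrix = F₂ → F₂ → ℂ

  I X′ : Matrix
  I 0ℙ 0ℙ = 1#
  I 0ℙ 1ℙ = 0#
  I 1ℙ 0ℙ = 0#
  I 1ℙ 1ℙ = 1#
  X′ _ 0ℙ = ½
  X′ _ 1ℙ = - ½

  -- M₁ ⊗ ⋯ ⊗ Mₙ has (v, w) entry ∏ⱼ Mⱼ(vⱼ, wⱼ) on (ℂ²)^⊗n ≅ (F₂^ n → ℂ).
  ⨂ : ∀ {n} → (Fin n → Matrix) → (F₂^ n → ℂ) → F₂^ n → ℂ
  ⨂ {n} M f v = Σ[ w ∈ allVectors n ] ((Π[ j < n ] M j (lookup v j) (lookup w j)) * f w)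

  X̃′ : ∀ {n} → (F₂^ n → ℂ) → F₂^ n → ℂ
  X̃′ {n} f v = Σ[ j < n ] ⨂ (λ i → if does (i ≟ j) then X′ else I) f v

  _∈𝒟⁰_ : ∀ {n} → (F₂^ n → ℂ) → ℕ → Set
  Q ∈𝒟⁰ d = Q ∈𝒟 d × (∀ v → X̃′ Q v ≈ 0#)

{-# OPTIONS --safe #-}

-- Two facts combine. Poisson summation: |C⊥| ∑_{c ∈ C} f(c) is the sum over C⊥
-- of the Walsh–Hadamard transform of f. And the transform of
-- f(v) = Q(v) x^(n - wt v) y^(wt v): for Q = ∏_{j ∈ J} (-1)^{vⱼ} it factors over
-- the coordinates, and (x² - y²)^|J| times it is the weight monomial in x + y, x - y
-- times ∏_{j ∈ J} (t + ρ (-1)^{uⱼ}), where t = x² + y² and ρ = -2xy. Expanding in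
-- powers of t, this product is ∑ₖ tᵏ ρ^{|J|-k} (X̃′ᵏ/k!) applied to the character.
-- By linearity this holds for every Q in 𝒟_d, and for harmonic Q only the term
-- ρᵈ Q(u) survives.

module Submission where

open import Algebra.Bundles using (CommutativeRing)
open import Data.Bool.Base using (if_then_else_)
open import Data.Fin.Base using (Fin; zero; suc)
open import Data.Fin.Properties using () renaming (_≟_ to _≟ᶠ_)
open import Data.Fin.Subset using (Subset; ∣_∣; inside; outside)
open import Data.List.Base using (List; []; _∷_; _++_; filter; length; map)
open import Data.List.Properties using (++-identityʳ)
import Data.List.Membership.Propositional as List
open import Data.List.Membership.Propositional.Properties using (∈-filter⁺; ∈-filter⁻)
import Data.List.Relation.Unary.All as All
open import Data.List.Relation.Unary.All.Properties using (¬All⇒Any¬)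
open import Data.Nat.Base as ℕ using (ℕ; zero; suc; s≤s)
import Data.Nat.Properties as ℕ
open import Data.Parity.Base as ℙ using (0ℙ; 1ℙ) renaming (Parity to F₂)
import Data.Parity.Properties as ℙ
open import Data.Product.Base using (∃; _×_; _,_; proj₂)
open import Data.Vec.Base as Vec using ([]; _∷_; replicate; zipWith)
open import Data.Vec.Properties using (count≤n)
open import Function.Base using (_∘_)
open import Relation.Binary.PropositionalEquality as ≡ using (_≡_)
open import Relation.Nullary.Decidable using (Dec; does; yes; no; ¬?)
open import Relation.Nullary.Negation using (¬_; contradiction)
open import Relation.Unary using (Decidable)
open import Defs
open Code using (size)

open CommutativeRing ℂ-commutativeRing
  using ( setoid; refl; sym; trans; reflexive; ring; semiring; commutativeSemiring; +-monoid
        ; +-cong; +-congˡ; +-congʳ; +-comm; +-identityˡ; +-identityʳ; -‿inverseʳ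
        ; *-cong; *-congˡ; *-congʳ; *-comm; *-assoc; *-identityˡ; *-identityʳ; zeroˡ; zeroʳ)
open import Algebra.Properties.Ring ring using (-1*x≈-x)
open import Algebra.Properties.Monoid.Sum +-monoid using (sum-cong-≋)
open import Algebra.Properties.Semiring.Exp semiring using (^-congˡ)
open import Algebra.Properties.CommutativeSemiring.Exp commutativeSemiring using (^-distrib-*)
open import Algebra.Solver.Ring.NaturalCoefficients.Default commutativeSemiring
  using (solve; con; _:+_; _:*_; _:=_)
open import Relation.Binary.Reasoning.Setoid setoid

-- A character of positive degree is not harmonic, so the higher terms cannot be discarded character
-- by character. The transform identity is therefore kept linear in Q, with every divided power of
-- `X̃′` present, and harmonicity is used only once the identity has been extended to 𝒟_d. The
-- constants come from one coordinate. With s = (-1)^{uⱼ}, a coordinate outside J transforms to x +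
-- s y and one in J to x - s y. Since s² = 1, (x - s y)(x² - y²) = (x + s y)(x - s y)² and (x - s
-- y)² = t + ρ s. This costs one factor x² - y² per element of J, and the 2 in ρ accounts for the
-- 2^d of the theorem. On functions of s, X′ acts as d/ds. The expansion in powers of t is thus
-- Taylor's formula for shifting every sign by t/ρ in ∏ sⱼ, cleared of denominators. Division by x²
-- - y² and by √2 is postponed to the final computation.

private
  variable
    A B : Set
    n d : ℕ

-- The semiring solver knows no subtraction, so negatives are written as
-- multiples of ε, with 1 + ε = 0 supplied by hand.
ε : ℂ
ε = - 1#

1+ε≈0 : 1# + ε ≈ 0#
1+ε≈0 = -‿inverseʳ 1#

ε*ε≈1 : ε * ε ≈ 1#
ε*ε≈1 = begin
  ε * ε                        ≈⟨ +-identityʳ (ε * ε) ⟨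
  ε * ε + 0#                   ≈⟨ +-congˡ 1+ε≈0 ⟨
  ε * ε + (1# + ε)             ≈⟨ solve 1 (λ e → e :* e :+ (con 1 :+ e) := con 1 :+ e :* (con 1 :+ e))
                                    refl ε ⟩
  1# + ε * (1# + ε)            ≈⟨ +-congˡ (trans (*-congˡ 1+ε≈0) (zeroʳ ε)) ⟩
  1# + 0#                      ≈⟨ +-identityʳ 1# ⟩
  1#                           ∎

-- Whether a complex number is zero is not decidable here, so cancellation works with an explicit
-- inverse.
*-cancelˡ-invertible : ∀ {c c⁻¹ x y} → c * c⁻¹ ≈ 1# → c * x ≈ c * y → x ≈ y
*-cancelˡ-invertible {c} {c⁻¹} {x} {y} inv eq = begin
  x                 ≈⟨ lem x ⟩
  c⁻¹ * (c * x)     ≈⟨ *-congˡ eq ⟩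
  c⁻¹ * (c * y)     ≈⟨ lem y ⟨
  y                 ∎
  where
  lem : ∀ z → z ≈ c⁻¹ * (c * z)
  lem z = begin
    z                 ≈⟨ *-identityˡ z ⟨
    1# * z            ≈⟨ *-congʳ inv ⟨
    c * c⁻¹ * z       ≈⟨ solve 3 (λ c i z → c :* i :* z := i :* (c :* z)) refl c c⁻¹ z ⟩
    c⁻¹ * (c * z)     ∎

-- Linear functionals

infix 4 _≗ℂ_

_≗ℂ_ : (A → ℂ) → (A → ℂ) → Set
f ≗ℂ g = ∀ a → f a ≈ g a

-- Only scalar-valued maps are covered: an operator on functions is treated as a family of
-- functionals, one for each point of evaluation, as in `∘-isLinear`. Functions are compared
-- pointwise up to `≈`, hence the field `cong`.
record IsLinear {A : Set} (T : (A → ℂ) → ℂ) : Set where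
  field
    cong   : ∀ {f g} → f ≗ℂ g → T f ≈ T g
    linear : ∀ a b f g → T (λ v → a * f v + b * g v) ≈ a * T f + b * T g

  additive : ∀ f g → T (λ v → f v + g v) ≈ T f + T g
  additive f g = begin
    T (λ v → f v + g v)               ≈⟨ cong (λ v → +-cong (*-identityˡ (f v)) (*-identityˡ (g v))) ⟨
    T (λ v → 1# * f v + 1# * g v)     ≈⟨ linear 1# 1# f g ⟩
    1# * T f + 1# * T g               ≈⟨ +-cong (*-identityˡ (T f)) (*-identityˡ (T g)) ⟩
    T f + T g                         ∎

  zeroFunctional : T (λ _ → 0#) ≈ 0#
  zeroFunctional = begin
    T (λ _ → 0#)                      ≈⟨ cong (λ _ → null 0# 0#) ⟨
    T (λ v → 0# * 0# + 0# * 0#)       ≈⟨ linear 0# 0# (λ _ → 0#) (λ _ → 0#) ⟩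
    0# * T (λ _ → 0#) + 0# * T (λ _ → 0#) ≈⟨ null (T (λ _ → 0#)) (T (λ _ → 0#)) ⟩
    0#                                ∎
    where
    null : ∀ z w → 0# * z + 0# * w ≈ 0#
    null z w = trans (+-cong (zeroˡ z) (zeroˡ w)) (+-identityˡ 0#)

  homogeneous : ∀ c f → T (λ v → c * f v) ≈ c * T f
  homogeneous c f = begin
    T (λ v → c * f v)                 ≈⟨ cong (λ v → drop (c * f v) (f v)) ⟨
    T (λ v → c * f v + 0# * f v)      ≈⟨ linear c 0# f f ⟩
    c * T f + 0# * T f                ≈⟨ drop (c * T f) (T f) ⟩
    c * T f                           ∎
    where
    drop : ∀ z w → z + 0# * w ≈ z
    drop z w = trans (+-congˡ (zeroˡ w)) (+-identityʳ z)

  vanishes : ∀ {f} → f ≗ℂ (λ _ → 0#) → T f ≈ 0#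
  vanishes f≈0 = trans (cong f≈0) zeroFunctional

open IsLinear

evaluation-isLinear : (a : A) → IsLinear (λ f → f a)
evaluation-isLinear a .cong eq = eq a
evaluation-isLinear a .linear _ _ _ _ = refl

zero-isLinear : IsLinear {A} (λ _ → 0#)
zero-isLinear .cong _ = refl
zero-isLinear .linear a b f g = sym (trans (+-cong (zeroʳ a) (zeroʳ b)) (+-identityˡ 0#))

+-isLinear : {T U : (A → ℂ) → ℂ} → IsLinear T → IsLinear U → IsLinear (λ f → T f + U f)
+-isLinear t u .cong eq = +-cong (cong t eq) (cong u eq)
+-isLinear {T = T} {U} t u .linear a b f g = trans (+-cong (linear t a b f g) (linear u a b f g))
  (solve 6 (λ a b p q r s → a :* p :+ b :* q :+ (a :* r :+ b :* s) := a :* (p :+ r) :+ b :* (q :+ s))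
    refl a b (T f) (T g) (U f) (U g))

*-isLinear : ∀ c {T : (A → ℂ) → ℂ} → IsLinear T → IsLinear (λ f → c * T f)
*-isLinear c t .cong eq = *-congˡ (cong t eq)
*-isLinear c {T} t .linear a b f g = trans (*-congˡ (linear t a b f g))
  (solve 5 (λ c a b p q → c :* (a :* p :+ b :* q) := a :* (c :* p) :+ b :* (c :* q))
    refl c a b (T f) (T g))

∘-isLinear : {T : (B → ℂ) → ℂ} {L : (A → ℂ) → B → ℂ} → IsLinear T → (∀ b → IsLinear (λ f → L f b)) →
             IsLinear (λ f → T (L f))
∘-isLinear t l .cong eq = cong t λ b → cong (l b) eq
∘-isLinear {L = L} t l .linear a b f g =
  trans (cong t λ v → linear (l v) a b f g) (linear t a b (L f) (L g))

sumOver-isLinear : (xs : List A) → IsLinear (sumOver xs)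
sumOver-isLinear []       = zero-isLinear
sumOver-isLinear (x ∷ xs) = +-isLinear (evaluation-isLinear x) (sumOver-isLinear xs)

linear-sum : {T : (A → ℂ) → ℂ} → IsLinear T → ∀ m (c : Fin m → ℂ) (f : Fin m → A → ℂ) →
             T (λ v → Σ[ i < m ] (c i * f i v)) ≈ (Σ[ i < m ] (c i * T (f i)))
linear-sum t zero    c f = zeroFunctional t
linear-sum {T = T} t (suc m) c f = begin
  T (λ v → c zero * f zero v + rest v)
    ≈⟨ cong t (λ v → +-congˡ (*-identityˡ (rest v))) ⟨
  T (λ v → c zero * f zero v + 1# * rest v)
    ≈⟨ linear t (c zero) 1# (f zero) rest ⟩
  c zero * T (f zero) + 1# * T rest
    ≈⟨ +-congˡ (*-identityˡ (T rest)) ⟩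
  c zero * T (f zero) + T rest
    ≈⟨ +-congˡ (linear-sum t m (c ∘ suc) (f ∘ suc)) ⟩
  c zero * T (f zero) + (Σ[ i < m ] (c (suc i) * T (f (suc i)))) ∎
  where
  rest : _ → ℂ
  rest v = Σ[ i < m ] (c (suc i) * f (suc i) v)

-- Reduces an identity linear in Q to characters of degree d, where it can be proved one coordinate
-- at a time.
linear-ext-𝒟 : {T U : (F₂^ n → ℂ) → ℂ} → IsLinear T → IsLinear U →
               (∀ J → ∣ J ∣ ≡ d → T (χ J) ≈ U (χ J)) → ∀ {Q} → Q ∈𝒟 d → T Q ≈ U Q
linear-ext-𝒟 {T = T} {U} t u eq {Q} Q∈𝒟 = begin
  T Q                                                       ≈⟨ cong t combination ⟩
  T (λ v → Σ[ i < terms ] (coefficient i * χ (index i) v))  ≈⟨ linear-sum t terms coefficient (χ ∘ index) ⟩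
  (Σ[ i < terms ] (coefficient i * T (χ (index i))))
    ≈⟨ sum-cong-≋ {terms} (λ i → *-congˡ (eq (index i) (degree i))) ⟩
  (Σ[ i < terms ] (coefficient i * U (χ (index i))))        ≈⟨ linear-sum u terms coefficient (χ ∘ index) ⟨
  U (λ v → Σ[ i < terms ] (coefficient i * χ (index i) v))  ≈⟨ cong u combination ⟨
  U Q                                                       ∎
  where open _∈𝒟_ Q∈𝒟

-- Sums over lists, indicators and signs

sumOver-++ : (xs ys : List A) (f : A → ℂ) → sumOver (xs ++ ys) f ≈ sumOver xs f + sumOver ys f
sumOver-++ []       ys f = sym (+-identityˡ (sumOver ys f))
sumOver-++ (x ∷ xs) ys f = trans (+-congˡ (sumOver-++ xs ys f))
  (solve 3 (λ a b c → a :+ (b :+ c) := a :+ b :+ c) refl (f x) (sumOver xs f) (sumOver ys f))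

sumOver-map : (g : A → B) (xs : List A) (f : B → ℂ) → sumOver (map g xs) f ≡ sumOver xs (f ∘ g)
sumOver-map g []       f = ≡.refl
sumOver-map g (x ∷ xs) f = ≡.cong (f (g x) +_) (sumOver-map g xs f)

𝟙 : {P : Set} → Dec P → ℂ
𝟙 P? = if does P? then 1# else 0#

sumOver-filter : {P : A → Set} (P? : Decidable P) (xs : List A) (f : A → ℂ) →
                 sumOver (filter P? xs) f ≈ sumOver xs (λ a → 𝟙 (P? a) * f a)
sumOver-filter P? []       f = refl
sumOver-filter P? (x ∷ xs) f with P? x
... | yes _ = +-cong (sym (*-identityˡ (f x))) (sumOver-filter P? xs f)
... | no  _ = trans (sumOver-filter P? xs f)
  (sym (trans (+-congʳ (zeroˡ (f x))) (+-identityˡ (sumOver xs λ a → 𝟙 (P? a) * f a))))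

sumOver-1 : (xs : List A) → sumOver xs (λ _ → 1#) ≡ fromℕ (length xs)
sumOver-1 []       = ≡.refl
sumOver-1 (x ∷ xs) = ≡.cong (1# +_) (sumOver-1 xs)

sumOver-allVectors : ∀ n (f : F₂^ (suc n) → ℂ) →
  sumOver (allVectors (suc n)) f ≈
  sumOver (allVectors n) (f ∘ (0ℙ ∷_)) + sumOver (allVectors n) (f ∘ (1ℙ ∷_))
sumOver-allVectors n f = begin
  sumOver (map (0ℙ ∷_) vs ++ (map (1ℙ ∷_) vs ++ [])) f
    ≈⟨ sumOver-++ (map (0ℙ ∷_) vs) (map (1ℙ ∷_) vs ++ []) f ⟩
  sumOver (map (0ℙ ∷_) vs) f + sumOver (map (1ℙ ∷_) vs ++ []) f
    ≡⟨ ≡.cong₂ _+_ (sumOver-map (0ℙ ∷_) vs f)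
         (≡.trans (≡.cong (λ ws → sumOver ws f) (++-identityʳ (map (1ℙ ∷_) vs))) (sumOver-map (1ℙ ∷_) vs f)) ⟩
  sumOver vs (f ∘ (0ℙ ∷_)) + sumOver vs (f ∘ (1ℙ ∷_)) ∎
  where vs = allVectors n

sgn-homo-+ : ∀ a b → sgn (a ℙ.+ b) ≈ sgn a * sgn b
sgn-homo-+ 0ℙ b  = sym (*-identityˡ (sgn b))
sgn-homo-+ 1ℙ 0ℙ = sym (*-identityʳ ε)
sgn-homo-+ 1ℙ 1ℙ = sym ε*ε≈1

sgn*sgn≈1 : ∀ a → sgn a * sgn a ≈ 1#
sgn*sgn≈1 0ℙ = *-identityˡ 1#
sgn*sgn≈1 1ℙ = ε*ε≈1

-- The Walsh–Hadamard transform

-- The recursion is that of the fast transform: the first coordinate is summed out with its sign.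
-- Inductions on the length then follow the definition, and `walsh-sum` recovers the character sum.
walsh : F₂^ n → (F₂^ n → ℂ) → ℂ
walsh []      f = f []
walsh (a ∷ u) f = walsh u λ v → f (0ℙ ∷ v) + sgn a * f (1ℙ ∷ v)

walsh-isLinear : (u : F₂^ n) → IsLinear (walsh u)
walsh-isLinear []      = evaluation-isLinear []
walsh-isLinear (a ∷ u) = ∘-isLinear (walsh-isLinear u) λ v →
  +-isLinear (evaluation-isLinear (0ℙ ∷ v)) (*-isLinear (sgn a) (evaluation-isLinear (1ℙ ∷ v)))

walsh-sum : (u : F₂^ n) (f : F₂^ n → ℂ) → walsh u f ≈ sumOver (allVectors n) (λ v → sgn ⟨ u , v ⟩ * f v)
walsh-sum [] f = solve 1 (λ z → z := con 1 :* z :+ con 0) refl (f [])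
walsh-sum {suc n} (a ∷ u) f = begin
  walsh u (λ v → f (0ℙ ∷ v) + sgn a * f (1ℙ ∷ v))
    ≈⟨ walsh-sum u (λ v → f (0ℙ ∷ v) + sgn a * f (1ℙ ∷ v)) ⟩
  sumOver vs (λ v → sgn ⟨ u , v ⟩ * (f (0ℙ ∷ v) + sgn a * f (1ℙ ∷ v)))
    ≈⟨ cong (sumOver-isLinear vs) term ⟩
  sumOver vs (λ v → sgn ⟨ a ∷ u , 0ℙ ∷ v ⟩ * f (0ℙ ∷ v) + sgn ⟨ a ∷ u , 1ℙ ∷ v ⟩ * f (1ℙ ∷ v))
    ≈⟨ additive (sumOver-isLinear vs) _ _ ⟩
  sumOver vs (λ v → sgn ⟨ a ∷ u , 0ℙ ∷ v ⟩ * f (0ℙ ∷ v)) +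
  sumOver vs (λ v → sgn ⟨ a ∷ u , 1ℙ ∷ v ⟩ * f (1ℙ ∷ v))
    ≈⟨ sumOver-allVectors n (λ v → sgn ⟨ a ∷ u , v ⟩ * f v) ⟨
  sumOver (allVectors (suc n)) (λ v → sgn ⟨ a ∷ u , v ⟩ * f v) ∎
  where
  vs = allVectors n
  term : ∀ v → sgn ⟨ u , v ⟩ * (f (0ℙ ∷ v) + sgn a * f (1ℙ ∷ v)) ≈
               sgn ⟨ a ∷ u , 0ℙ ∷ v ⟩ * f (0ℙ ∷ v) + sgn ⟨ a ∷ u , 1ℙ ∷ v ⟩ * f (1ℙ ∷ v)
  term v = begin
    sgn ⟨ u , v ⟩ * (f (0ℙ ∷ v) + sgn a * f (1ℙ ∷ v))
      ≈⟨ solve 4 (λ s p σ q → s :* (p :+ σ :* q) := s :* p :+ σ :* s :* q) refl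
           (sgn ⟨ u , v ⟩) (f (0ℙ ∷ v)) (sgn a) (f (1ℙ ∷ v)) ⟩
    sgn ⟨ u , v ⟩ * f (0ℙ ∷ v) + sgn a * sgn ⟨ u , v ⟩ * f (1ℙ ∷ v)
      ≈⟨ +-congˡ (*-congʳ (sgn-homo-+ a ⟨ u , v ⟩)) ⟨
    sgn ⟨ u , v ⟩ * f (0ℙ ∷ v) + sgn (a ℙ.+ ⟨ u , v ⟩) * f (1ℙ ∷ v)
      ≡⟨ ≡.cong₂ (λ b c → sgn (b ℙ.+ ⟨ u , v ⟩) * f (0ℙ ∷ v) + sgn (c ℙ.+ ⟨ u , v ⟩) * f (1ℙ ∷ v))
           (ℙ.*-zeroʳ a) (ℙ.*-identityʳ a) ⟨
    sgn ⟨ a ∷ u , 0ℙ ∷ v ⟩ * f (0ℙ ∷ v) + sgn ⟨ a ∷ u , 1ℙ ∷ v ⟩ * f (1ℙ ∷ v) ∎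

two : ℂ
two = 1# + 1#

-- The transform is a tensor power of the matrix with rows (1, 1) and (1, -1), whose square is twice
-- the identity; `cases` is that square, row by row.
walsh-involutive : (w : F₂^ n) (f : F₂^ n → ℂ) → walsh w (λ u → walsh u f) ≈ two ^ n * f w
walsh-involutive [] f = sym (*-identityˡ (f []))
walsh-involutive {suc n} (a ∷ w) f = begin
  walsh w (λ u → walsh u (f± 0ℙ) + sgn a * walsh u (f± 1ℙ))
    ≈⟨ cong (walsh-isLinear w) (λ u → +-congˡ (homogeneous (walsh-isLinear u) (sgn a) (f± 1ℙ))) ⟨
  walsh w (λ u → walsh u (f± 0ℙ) + walsh u (λ v → sgn a * f± 1ℙ v))
    ≈⟨ cong (walsh-isLinear w) (λ u → additive (walsh-isLinear u) (f± 0ℙ) (λ v → sgn a * f± 1ℙ v)) ⟨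
  walsh w (λ u → walsh u (λ v → f± 0ℙ v + sgn a * f± 1ℙ v))
    ≈⟨ walsh-involutive w (λ v → f± 0ℙ v + sgn a * f± 1ℙ v) ⟩
  two ^ n * (f± 0ℙ w + sgn a * f± 1ℙ w)
    ≈⟨ *-congˡ (cases a) ⟩
  two ^ n * (two * f (a ∷ w))
    ≈⟨ solve 3 (λ p t z → p :* (t :* z) := t :* p :* z) refl (two ^ n) two (f (a ∷ w)) ⟩
  two * two ^ n * f (a ∷ w) ∎
  where
  f± : F₂ → F₂^ n → ℂ
  f± b v = f (0ℙ ∷ v) + sgn b * f (1ℙ ∷ v)
  cases : ∀ a → f± 0ℙ w + sgn a * f± 1ℙ w ≈ two * f (a ∷ w)
  cases 0ℙ = begin
    p + 1# * q + 1# * (p + ε * q)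
      ≈⟨ solve 3 (λ p q e → p :+ con 1 :* q :+ con 1 :* (p :+ e :* q) := (con 1 :+ con 1) :* p :+ (con 1 :+ e) :* q)
           refl p q ε ⟩
    two * p + (1# + ε) * q   ≈⟨ +-congˡ (trans (*-congʳ 1+ε≈0) (zeroˡ q)) ⟩
    two * p + 0#             ≈⟨ +-identityʳ (two * p) ⟩
    two * p                  ∎
    where p = f (0ℙ ∷ w)
          q = f (1ℙ ∷ w)
  cases 1ℙ = begin
    p + 1# * q + ε * (p + ε * q)
      ≈⟨ solve 3 (λ p q e → p :+ con 1 :* q :+ e :* (p :+ e :* q) := (con 1 :+ e :* e) :* q :+ (con 1 :+ e) :* p)
           refl p q ε ⟩
    (1# + ε * ε) * q + (1# + ε) * p  ≈⟨ +-cong (*-congʳ (+-congˡ ε*ε≈1)) (trans (*-congʳ 1+ε≈0) (zeroˡ p)) ⟩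
    two * q + 0#             ≈⟨ +-identityʳ (two * q) ⟩
    two * q                  ∎
    where p = f (0ℙ ∷ w)
          q = f (1ℙ ∷ w)

-- The same two by two matrix is symmetric, and so are its tensor powers.
walsh-selfAdjoint : ∀ n (f g : F₂^ n → ℂ) →
  sumOver (allVectors n) (λ u → walsh u f * g u) ≈ sumOver (allVectors n) (λ v → f v * walsh v g)
walsh-selfAdjoint zero    f g = refl
walsh-selfAdjoint (suc n) f g = begin
  sumOver (allVectors (suc n)) (λ u → walsh u f * g u)
    ≈⟨ sumOver-allVectors n (λ u → walsh u f * g u) ⟩
  sumOver vs (λ u → walsh u (f± 0ℙ) * g₀ u) + sumOver vs (λ u → walsh u (f± 1ℙ) * g₁ u)
    ≈⟨ +-cong (walsh-selfAdjoint n (f± 0ℙ) g₀) (walsh-selfAdjoint n (f± 1ℙ) g₁) ⟩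
  sumOver vs (λ v → f± 0ℙ v * walsh v g₀) + sumOver vs (λ v → f± 1ℙ v * walsh v g₁)
    ≈⟨ additive (sumOver-isLinear vs) _ _ ⟨
  sumOver vs (λ v → f± 0ℙ v * walsh v g₀ + f± 1ℙ v * walsh v g₁)
    ≈⟨ cong (sumOver-isLinear vs) term ⟩
  sumOver vs (λ v → f (0ℙ ∷ v) * walsh (0ℙ ∷ v) g + f (1ℙ ∷ v) * walsh (1ℙ ∷ v) g)
    ≈⟨ additive (sumOver-isLinear vs) _ _ ⟩
  sumOver vs (λ v → f (0ℙ ∷ v) * walsh (0ℙ ∷ v) g) + sumOver vs (λ v → f (1ℙ ∷ v) * walsh (1ℙ ∷ v) g)
    ≈⟨ sumOver-allVectors n (λ v → f v * walsh v g) ⟨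
  sumOver (allVectors (suc n)) (λ v → f v * walsh v g) ∎
  where
  vs = allVectors n
  f± : F₂ → F₂^ n → ℂ
  f± b v = f (0ℙ ∷ v) + sgn b * f (1ℙ ∷ v)
  g₀ g₁ : F₂^ n → ℂ
  g₀ v = g (0ℙ ∷ v)
  g₁ v = g (1ℙ ∷ v)
  split : ∀ a v → walsh (a ∷ v) g ≈ walsh v g₀ + sgn a * walsh v g₁
  split a v = trans (additive (walsh-isLinear v) g₀ (λ w → sgn a * g₁ w))
                    (+-congˡ (homogeneous (walsh-isLinear v) (sgn a) g₁))
  term : ∀ v → f± 0ℙ v * walsh v g₀ + f± 1ℙ v * walsh v g₁ ≈
               f (0ℙ ∷ v) * walsh (0ℙ ∷ v) g + f (1ℙ ∷ v) * walsh (1ℙ ∷ v) g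
  term v = trans
    (solve 5 (λ p q e r s → (p :+ con 1 :* q) :* r :+ (p :+ e :* q) :* s := p :* (r :+ con 1 :* s) :+ q :* (r :+ e :* s))
      refl (f (0ℙ ∷ v)) (f (1ℙ ∷ v)) ε (walsh v g₀) (walsh v g₁))
    (sym (+-cong (*-congˡ (split 0ℙ v)) (*-congˡ (split 1ℙ v))))

-- Translating by 1 in a coordinate swaps its two values. As `sgn a` squares to 1, this amounts to
-- multiplying the pair's combination by `sgn a`.
walsh-translate : (u c : F₂^ n) (f : F₂^ n → ℂ) →
  walsh u (λ v → f (zipWith ℙ._+_ v c)) ≈ sgn ⟨ u , c ⟩ * walsh u f
walsh-translate []      []       f = sym (*-identityˡ (f []))
walsh-translate (a ∷ u) (0ℙ ∷ c) f = begin
  walsh u (λ v → g (zipWith ℙ._+_ v c))       ≈⟨ walsh-translate u c g ⟩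
  sgn ⟨ u , c ⟩ * walsh u g                   ≡⟨ ≡.cong (λ b → sgn (b ℙ.+ ⟨ u , c ⟩) * walsh u g) (ℙ.*-zeroʳ a) ⟨
  sgn ⟨ a ∷ u , 0ℙ ∷ c ⟩ * walsh (a ∷ u) f    ∎
  where g = λ v → f (0ℙ ∷ v) + sgn a * f (1ℙ ∷ v)
walsh-translate (a ∷ u) (1ℙ ∷ c) f = begin
  walsh u (λ v → f (1ℙ ∷ zipWith ℙ._+_ v c) + sgn a * f (0ℙ ∷ zipWith ℙ._+_ v c))
    ≈⟨ walsh-translate u c (λ v → f (1ℙ ∷ v) + sgn a * f (0ℙ ∷ v)) ⟩
  sgn ⟨ u , c ⟩ * walsh u (λ v → f (1ℙ ∷ v) + sgn a * f (0ℙ ∷ v))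
    ≈⟨ *-congˡ (cong (walsh-isLinear u) flip) ⟩
  sgn ⟨ u , c ⟩ * walsh u (λ v → sgn a * g v)
    ≈⟨ *-congˡ (homogeneous (walsh-isLinear u) (sgn a) g) ⟩
  sgn ⟨ u , c ⟩ * (sgn a * walsh u g)
    ≈⟨ solve 3 (λ s a w → s :* (a :* w) := a :* s :* w) refl (sgn ⟨ u , c ⟩) (sgn a) (walsh u g) ⟩
  sgn a * sgn ⟨ u , c ⟩ * walsh u g
    ≈⟨ *-congʳ (sgn-homo-+ a ⟨ u , c ⟩) ⟨
  sgn (a ℙ.+ ⟨ u , c ⟩) * walsh u g
    ≡⟨ ≡.cong (λ b → sgn (b ℙ.+ ⟨ u , c ⟩) * walsh u g) (ℙ.*-identityʳ a) ⟨
  sgn ⟨ a ∷ u , 1ℙ ∷ c ⟩ * walsh (a ∷ u) f ∎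
  where
  g = λ v → f (0ℙ ∷ v) + sgn a * f (1ℙ ∷ v)
  flip : (λ v → f (1ℙ ∷ v) + sgn a * f (0ℙ ∷ v)) ≗ℂ (λ v → sgn a * g v)
  flip v = begin
    f (1ℙ ∷ v) + sgn a * f (0ℙ ∷ v)
      ≈⟨ +-congʳ (trans (*-congʳ (sgn*sgn≈1 a)) (*-identityˡ (f (1ℙ ∷ v)))) ⟨
    sgn a * sgn a * f (1ℙ ∷ v) + sgn a * f (0ℙ ∷ v)
      ≈⟨ solve 3 (λ a p q → a :* a :* q :+ a :* p := a :* (p :+ a :* q))
           refl (sgn a) (f (0ℙ ∷ v)) (f (1ℙ ∷ v)) ⟩
    sgn a * g v ∎

-- Poisson summation over a code

+-involutive : (v c : F₂^ n) → zipWith ℙ._+_ (zipWith ℙ._+_ v c) c ≡ v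
+-involutive []      []      = ≡.refl
+-involutive (a ∷ v) (b ∷ c) = ≡.cong₂ _∷_ (lem a b) (+-involutive v c)
  where
  lem : ∀ a b → a ℙ.+ b ℙ.+ b ≡ a
  lem a 0ℙ = ≡.trans (ℙ.+-identityʳ (a ℙ.+ 0ℙ)) (ℙ.+-identityʳ a)
  lem 0ℙ 1ℙ = ≡.refl
  lem 1ℙ 1ℙ = ≡.refl

𝟙-cong : {P Q : Set} → (P → Q) → (Q → P) → (P? : Dec P) (Q? : Dec Q) → 𝟙 P? ≡ 𝟙 Q?
𝟙-cong to from (yes p) (yes q) = ≡.refl
𝟙-cong to from (yes p) (no ¬q) = contradiction (to p) ¬q
𝟙-cong to from (no ¬p) (yes q) = contradiction (from q) ¬p
𝟙-cong to from (no ¬p) (no ¬q) = ≡.refl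

x≈εx⇒x≈0 : ∀ {x} → x ≈ ε * x → x ≈ 0#
x≈εx⇒x≈0 {x} eq = begin
  x                ≈⟨ trans (*-congʳ ½+½≈1) (*-identityˡ x) ⟨
  (½ + ½) * x      ≈⟨ solve 2 (λ h x → (h :+ h) :* x := h :* (x :+ x)) refl ½ x ⟩
  ½ * (x + x)      ≈⟨ *-congˡ (+-congˡ eq) ⟩
  ½ * (x + ε * x)  ≈⟨ solve 3 (λ h x e → h :* (x :+ e :* x) := h :* x :* (con 1 :+ e)) refl ½ x ε ⟩
  ½ * x * (1# + ε) ≈⟨ trans (*-congˡ 1+ε≈0) (zeroʳ (½ * x)) ⟩
  0#               ∎

module _ {n : ℕ} (C : Code n) where

  open Code C hiding (size)
  open Code (C ⊥) using () renaming (Member to Member⊥; member? to member⊥?; codewords to codewords⊥)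

  private
    vs = allVectors n
    N N⊥ : ℂ
    N  = fromℕ (size C)
    N⊥ = fromℕ (size (C ⊥))

    𝟙C 𝟙C⊥ : F₂^ n → ℂ
    𝟙C  v = 𝟙 (member? v)
    𝟙C⊥ v = 𝟙 (member⊥? v)

    sumOver-𝟙 : (D : Code n) → sumOver vs (λ v → 𝟙 (Code.member? D v)) ≈ fromℕ (size D)
    sumOver-𝟙 D = begin
      sumOver vs (λ v → 𝟙 (D.member? v))         ≈⟨ cong (sumOver-isLinear vs) (λ v → *-identityʳ (𝟙 (D.member? v))) ⟨
      sumOver vs (λ v → 𝟙 (D.member? v) * 1#)    ≈⟨ sumOver-filter D.member? vs (λ _ → 1#) ⟨
      sumOver D.codewords (λ _ → 1#)              ≡⟨ sumOver-1 D.codewords ⟩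
      fromℕ D.size                                ∎
      where module D = Code D

    -- The codewords form a finite list and orthogonality is decidable, so a failed universal
    -- statement yields an actual witness.
    nonorthogonal : ∀ u → ¬ Member⊥ u → ∃ λ c → Member c × ⟨ u , c ⟩ ≡ 1ℙ
    nonorthogonal u u∉C⊥ =
      let c , c∈ , uc≢0 = List.find (¬All⇒Any¬ (λ c → ⟨ u , c ⟩ ℙ.≟ 0ℙ) codewords
                            λ all → u∉C⊥ λ c∈C → All.lookup all (∈-filter⁺ member? (∈-allVectors _) c∈C))
      in c , proj₂ (∈-filter⁻ member? {xs = vs} c∈) , ≢0⇒≡1 uc≢0
      where
      ≢0⇒≡1 : ∀ {a} → ¬ a ≡ 0ℙ → a ≡ 1ℙ
      ≢0⇒≡1 {0ℙ} ≢0 = contradiction ≡.refl ≢0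
      ≢0⇒≡1 {1ℙ} _  = ≡.refl

  -- Orthogonality of characters. If u is in the dual, every sign on C is 1. Otherwise translation
  -- by a codeword c with ⟨u, c⟩ = 1 preserves the indicator of C and negates its transform at u,
  -- which must then be zero.
  walsh-𝟙C : ∀ u → walsh u 𝟙C ≈ 𝟙C⊥ u * N
  walsh-𝟙C u = cases (member⊥? u)
    where
    cases : (u∈? : Dec (Member⊥ u)) → walsh u 𝟙C ≈ 𝟙 u∈? * N
    cases (yes u∈C⊥) = begin
      walsh u 𝟙C                                   ≈⟨ walsh-sum u 𝟙C ⟩
      sumOver vs (λ v → sgn ⟨ u , v ⟩ * 𝟙C v)      ≈⟨ cong (sumOver-isLinear vs) (λ v → term v (member? v)) ⟩
      sumOver vs 𝟙C                                ≈⟨ sumOver-𝟙 C ⟩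
      N                                            ≈⟨ *-identityˡ N ⟨
      1# * N                                       ∎
      where
      term : ∀ v (v∈? : Dec (Member v)) → sgn ⟨ u , v ⟩ * 𝟙 v∈? ≈ 𝟙 v∈?
      term v (yes v∈C) = trans (*-congʳ (reflexive (≡.cong sgn (u∈C⊥ v∈C)))) (*-identityˡ 1#)
      term v (no  _)   = zeroʳ (sgn ⟨ u , v ⟩)
    cases (no u∉C⊥) =
      let c , c∈C , uc≡1 = nonorthogonal u u∉C⊥
      in trans (x≈εx⇒x≈0 (begin
        walsh u 𝟙C                                 ≈⟨ cong (walsh-isLinear u) (λ v → reflexive (shift c c∈C v)) ⟨
        walsh u (λ v → 𝟙C (zipWith ℙ._+_ v c))     ≈⟨ walsh-translate u c 𝟙C ⟩
        sgn ⟨ u , c ⟩ * walsh u 𝟙C                 ≡⟨ ≡.cong (λ b → sgn b * walsh u 𝟙C) uc≡1 ⟩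
        ε * walsh u 𝟙C                             ∎)) (sym (zeroˡ N))
      where
      shift : ∀ c → Member c → ∀ v → 𝟙C (zipWith ℙ._+_ v c) ≡ 𝟙C v
      shift c c∈C v = 𝟙-cong
        (λ v+c∈C → ≡.subst Member (+-involutive v c) (+-closed v+c∈C c∈C))
        (λ v∈C → +-closed v∈C c∈C)
        (member? (zipWith ℙ._+_ v c)) (member? v)

  -- The double transform of the indicator of C at 0 is computed twice: involution gives 2^n, while
  -- `walsh-𝟙C` gives |C| times the sum of the dual indicator. This takes the place of a dimension
  -- count.
  size*size⊥≈2^n : N * N⊥ ≈ two ^ n
  size*size⊥≈2^n = begin
    N * N⊥                                            ≈⟨ *-congˡ (sumOver-𝟙 (C ⊥)) ⟨
    N * sumOver vs 𝟙C⊥                                ≈⟨ *-congˡ (cong (sumOver-isLinear vs) term) ⟨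
    N * sumOver vs (λ u → sgn ⟨ 𝟎 , u ⟩ * 𝟙C⊥ u)     ≈⟨ *-congˡ (walsh-sum 𝟎 𝟙C⊥) ⟨
    N * walsh 𝟎 𝟙C⊥                                   ≈⟨ homogeneous (walsh-isLinear 𝟎) N 𝟙C⊥ ⟨
    walsh 𝟎 (λ u → N * 𝟙C⊥ u)                         ≈⟨ cong (walsh-isLinear 𝟎) (λ u → trans (walsh-𝟙C u) (*-comm (𝟙C⊥ u) N)) ⟨
    walsh 𝟎 (λ u → walsh u 𝟙C)                        ≈⟨ walsh-involutive 𝟎 𝟙C ⟩
    two ^ n * 𝟙C 𝟎                                    ≡⟨ ≡.cong (two ^ n *_) (𝟙-cong (λ _ → 0-closed) (λ z → z) (member? 𝟎) (yes 0-closed)) ⟩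
    two ^ n * 1#                                      ≈⟨ *-identityʳ (two ^ n) ⟩
    two ^ n                                           ∎
    where
    𝟎 : F₂^ n
    𝟎 = replicate n 0ℙ
    term : ∀ u → sgn ⟨ 𝟎 , u ⟩ * 𝟙C⊥ u ≈ 𝟙C⊥ u
    term u = trans (reflexive (≡.cong (λ b → sgn b * 𝟙C⊥ u) (⟨0,w⟩≡0 u))) (*-identityˡ (𝟙C⊥ u))

  poisson : (f : F₂^ n → ℂ) → N⊥ * sumOver codewords f ≈ sumOver codewords⊥ (λ u → walsh u f)
  -- The extra factor |C| completes |C⊥| to 2^n, which turns f into its double transform;
  -- self-adjointness then moves one of the two transforms onto the indicator of C.
  poisson f = *-cancelˡ-invertible (*-inverse N (size#0 C)) (begin
    N * (N⊥ * sumOver codewords f)                     ≈⟨ *-assoc N N⊥ _ ⟨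
    N * N⊥ * sumOver codewords f                       ≈⟨ *-cong size*size⊥≈2^n (sumOver-filter member? vs f) ⟩
    two ^ n * sumOver vs (λ v → 𝟙C v * f v)            ≈⟨ homogeneous (sumOver-isLinear vs) (two ^ n) _ ⟨
    sumOver vs (λ v → two ^ n * (𝟙C v * f v))          ≈⟨ cong (sumOver-isLinear vs) (λ v →
                                                            solve 3 (λ t i z → t :* (i :* z) := i :* (t :* z))
                                                              refl (two ^ n) (𝟙C v) (f v)) ⟩
    sumOver vs (λ v → 𝟙C v * (two ^ n * f v))          ≈⟨ cong (sumOver-isLinear vs) (λ v → *-congˡ (walsh-involutive v f)) ⟨
    sumOver vs (λ v → 𝟙C v * walsh v (λ u → walsh u f)) ≈⟨ walsh-selfAdjoint n 𝟙C (λ u → walsh u f) ⟨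
    sumOver vs (λ u → walsh u 𝟙C * walsh u f)          ≈⟨ cong (sumOver-isLinear vs) term ⟩
    sumOver vs (λ u → N * (𝟙C⊥ u * walsh u f))         ≈⟨ homogeneous (sumOver-isLinear vs) N _ ⟩
    N * sumOver vs (λ u → 𝟙C⊥ u * walsh u f)           ≈⟨ *-congˡ (sumOver-filter member⊥? vs (λ u → walsh u f)) ⟨
    N * sumOver codewords⊥ (λ u → walsh u f)           ∎)
    where
    term : ∀ u → walsh u 𝟙C * walsh u f ≈ N * (𝟙C⊥ u * walsh u f)
    term u = trans (*-congʳ (walsh-𝟙C u))
      (solve 3 (λ i n w → i :* n :* w := n :* (i :* w)) refl (𝟙C⊥ u) N (walsh u f))

-- Divided powers of X̃′

-- The two rows of `X′` agree, so applying it in the first coordinate gives a function that no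
-- longer depends on that coordinate. `δ f` is this function of the remaining ones: the derivative
-- in the first sign.
δ : (F₂^ (suc n) → ℂ) → F₂^ n → ℂ
δ f v = ½ * f (0ℙ ∷ v) + (- ½) * f (1ℙ ∷ v)

δ-isLinear : (v : F₂^ n) → IsLinear (λ f → δ f v)
δ-isLinear v = +-isLinear (*-isLinear ½ (evaluation-isLinear (0ℙ ∷ v)))
                          (*-isLinear (- ½) (evaluation-isLinear (1ℙ ∷ v)))

slice : F₂ → (F₂^ (suc n) → ℂ) → F₂^ n → ℂ
slice a f v = f (a ∷ v)

δ≈ : ∀ (f : F₂^ (suc n) → ℂ) v → δ f v ≈ ½ * (f (0ℙ ∷ v) + ε * f (1ℙ ∷ v))
δ≈ f v = begin
  ½ * p + (- ½) * q       ≈⟨ +-congˡ (*-congʳ (-1*x≈-x ½)) ⟨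
  ½ * p + (ε * ½) * q     ≈⟨ solve 4 (λ h e p q → h :* p :+ e :* h :* q := h :* (p :+ e :* q))
                               refl ½ ε p q ⟩
  ½ * (p + ε * q)         ∎
  where p = f (0ℙ ∷ v)
        q = f (1ℙ ∷ v)

-- e k = X̃′ᵏ / k!, the k-th elementary symmetric function of the commuting
-- square-zero operators X′ⱼ.
e : ℕ → (F₂^ n → ℂ) → F₂^ n → ℂ
e zero    f v       = f v
e (suc k) f []      = 0#
e (suc k) f (a ∷ v) = e (suc k) (slice a f) v + e k (δ f) v

e-isLinear : ∀ k (v : F₂^ n) → IsLinear (λ f → e k f v)
e-isLinear zero    v       = evaluation-isLinear v
e-isLinear (suc k) []      = zero-isLinear
e-isLinear (suc k) (a ∷ v) = +-isLinear
  (∘-isLinear (e-isLinear (suc k) v) (λ w → evaluation-isLinear (a ∷ w)))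
  (∘-isLinear (e-isLinear k v) δ-isLinear)

-- The summand of `e 1` acting on the first coordinate is constant there, so `δ` kills it; this is
-- where X′² = 0 enters.
δ-e₁ : (f : F₂^ (suc n) → ℂ) → δ (e 1 f) ≗ℂ e 1 (δ f)
δ-e₁ f v = begin
  δ (e 1 f) v
    ≈⟨ δ≈ (e 1 f) v ⟩
  ½ * ((e 1 (slice 0ℙ f) v + δ f v) + ε * (e 1 (slice 1ℙ f) v + δ f v))
    ≈⟨ solve 5 (λ h e a b c → h :* ((a :+ c) :+ e :* (b :+ c)) := h :* (a :+ e :* b) :+ h :* c :* (con 1 :+ e))
         refl ½ ε (e 1 (slice 0ℙ f) v) (e 1 (slice 1ℙ f) v) (δ f v) ⟩
  ½ * (e 1 (slice 0ℙ f) v + ε * e 1 (slice 1ℙ f) v) + ½ * δ f v * (1# + ε)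
    ≈⟨ trans (+-congˡ (trans (*-congˡ 1+ε≈0) (zeroʳ (½ * δ f v)))) (+-identityʳ _) ⟩
  ½ * (e 1 (slice 0ℙ f) v + ε * e 1 (slice 1ℙ f) v)
    ≈⟨ solve 4 (λ h e a b → h :* (a :+ e :* b) := h :* a :+ e :* h :* b)
         refl ½ ε (e 1 (slice 0ℙ f) v) (e 1 (slice 1ℙ f) v) ⟩
  ½ * e 1 (slice 0ℙ f) v + ε * ½ * e 1 (slice 1ℙ f) v
    ≈⟨ +-congˡ (*-congʳ (-1*x≈-x ½)) ⟩
  ½ * e 1 (slice 0ℙ f) v + (- ½) * e 1 (slice 1ℙ f) v
    ≈⟨ linear (e-isLinear 1 v) ½ (- ½) (slice 0ℙ f) (slice 1ℙ f) ⟨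
  e 1 (δ f) v ∎

-- A product of k + 1 distinct X′ⱼ arises from `e k` and `e 1` in k + 1 ways, one for each choice of
-- the factor supplied by `e 1`; products with a repeated factor vanish.
e-recurrence : ∀ k (f : F₂^ n → ℂ) v → e k (e 1 f) v ≈ fromℕ (suc k) * e (suc k) f v
e-recurrence zero    f v  = solve 1 (λ z → z := (con 1 :+ con 0) :* z) refl (e 1 f v)
e-recurrence (suc k) f [] = sym (zeroʳ (fromℕ (suc (suc k))))
e-recurrence (suc k) f (a ∷ v) = begin
  e (suc k) (λ w → e 1 (slice a f) w + δ f w) v + e k (δ (e 1 f)) v
    ≈⟨ +-cong (additive (e-isLinear (suc k) v) (e 1 (slice a f)) (δ f)) (cong (e-isLinear k v) (δ-e₁ f)) ⟩
  e (suc k) (e 1 (slice a f)) v + e (suc k) (δ f) v + e k (e 1 (δ f)) v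
    ≈⟨ +-cong (+-congʳ (e-recurrence (suc k) (slice a f) v)) (e-recurrence k (δ f) v) ⟩
  (1# + m) * e (suc (suc k)) (slice a f) v + e (suc k) (δ f) v + m * e (suc k) (δ f) v
    ≈⟨ solve 3 (λ m p q → (con 1 :+ m) :* p :+ q :+ m :* q := (con 1 :+ m) :* (p :+ q)) refl
         m (e (suc (suc k)) (slice a f) v) (e (suc k) (δ f) v) ⟩
  (1# + m) * (e (suc (suc k)) (slice a f) v + e (suc k) (δ f) v) ∎
  where m = fromℕ (suc k)

-- The tensor form of the lowering operator, and harmonicity

⨂-∷ : ∀ (M : Fin (suc n) → Matrix) (f : F₂^ (suc n) → ℂ) a v →
  ⨂ M f (a ∷ v) ≈ M zero a 0ℙ * ⨂ (M ∘ suc) (slice 0ℙ f) v + M zero a 1ℙ * ⨂ (M ∘ suc) (slice 1ℙ f) v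
⨂-∷ {n} M f a v = trans (sumOver-allVectors n _) (+-cong (part 0ℙ) (part 1ℙ))
  where
  Πv : F₂^ n → ℂ
  Πv w = Π[ j < n ] M (suc j) (Vec.lookup v j) (Vec.lookup w j)
  part : ∀ b → sumOver (allVectors n) (λ w → M zero a b * Πv w * f (b ∷ w)) ≈ M zero a b * ⨂ (M ∘ suc) (slice b f) v
  part b = trans (cong (sumOver-isLinear (allVectors n)) λ w → *-assoc (M zero a b) (Πv w) (f (b ∷ w)))
                 (homogeneous (sumOver-isLinear (allVectors n)) (M zero a b) λ w → Πv w * f (b ∷ w))

I-row : ∀ a (z : F₂ → ℂ) → I a 0ℙ * z 0ℙ + I a 1ℙ * z 1ℙ ≈ z a
I-row 0ℙ z = solve 2 (λ p q → con 1 :* p :+ con 0 :* q := p) refl (z 0ℙ) (z 1ℙ)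
I-row 1ℙ z = solve 2 (λ p q → con 0 :* p :+ con 1 :* q := q) refl (z 0ℙ) (z 1ℙ)

⨂-I : ∀ (f : F₂^ n → ℂ) v → ⨂ (λ _ → I) f v ≈ f v
⨂-I f [] = solve 1 (λ z → con 1 :* z :+ con 0 := z) refl (f [])
⨂-I f (a ∷ v) = begin
  ⨂ (λ _ → I) f (a ∷ v)                             ≈⟨ ⨂-∷ (λ _ → I) f a v ⟩
  I a 0ℙ * ⨂ (λ _ → I) (slice 0ℙ f) v + I a 1ℙ * ⨂ (λ _ → I) (slice 1ℙ f) v
                                                     ≈⟨ I-row a (λ b → ⨂ (λ _ → I) (slice b f) v) ⟩
  ⨂ (λ _ → I) (slice a f) v                         ≈⟨ ⨂-I (slice a f) v ⟩
  f (a ∷ v)                                          ∎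

X̃′≈e₁ : ∀ (f : F₂^ n → ℂ) v → X̃′ f v ≈ e 1 f v
X̃′≈e₁ f [] = refl
X̃′≈e₁ {suc n} f (a ∷ v) = begin
  ⨂ (M zero) f (a ∷ v) + (Σ[ j < n ] ⨂ (M (suc j)) f (a ∷ v))
    ≈⟨ +-cong first (sum-cong-≋ {n} rest) ⟩
  δ f v + X̃′ (slice a f) v
    ≈⟨ +-comm (δ f v) (X̃′ (slice a f) v) ⟩
  X̃′ (slice a f) v + δ f v
    ≈⟨ +-congʳ (X̃′≈e₁ (slice a f) v) ⟩
  e 1 (slice a f) v + δ f v ∎
  where
  M : ∀ {n} → Fin n → Fin n → Matrix
  M j i = if does (i ≟ᶠ j) then X′ else I
  first : ⨂ (M zero) f (a ∷ v) ≈ δ f v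
  first = trans (⨂-∷ (M zero) f a v) (+-cong (*-congˡ (⨂-I (slice 0ℙ f) v)) (*-congˡ (⨂-I (slice 1ℙ f) v)))
  rest : ∀ j → ⨂ (M (suc j)) f (a ∷ v) ≈ ⨂ (M j) (slice a f) v
  rest j = trans (⨂-∷ (M (suc j)) f a v) (I-row a λ b → ⨂ (M j) (slice b f) v)

-- The recurrence expresses (k + 1) `e (suc k) Q` through `e 1 Q`, which is zero; k + 1 can be
-- cancelled in characteristic zero.
e-harmonic : ∀ {Q : F₂^ n → ℂ} → (∀ v → X̃′ Q v ≈ 0#) → ∀ k v → e (suc k) Q v ≈ 0#
e-harmonic {Q = Q} X̃′Q≈0 k v = *-cancelˡ-invertible (*-inverse (fromℕ (suc k)) (fromℕ-#0 (suc k))) (begin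
  fromℕ (suc k) * e (suc k) Q v     ≈⟨ e-recurrence k Q v ⟨
  e k (e 1 Q) v                     ≈⟨ vanishes (e-isLinear k v) (λ w → trans (sym (X̃′≈e₁ Q w)) (X̃′Q≈0 w)) ⟩
  0#                                ≈⟨ zeroʳ (fromℕ (suc k)) ⟨
  fromℕ (suc k) * 0#                ∎)

-- The transform of a character weighted by monomials

select : ℂ → ℂ → F₂ → ℂ
select x y 0ℙ = x
select x y 1ℙ = y

monomial : ℂ → ℂ → F₂^ n → ℂ
monomial {n} x y v = x ^ (n ℕ.∸ wt v) * y ^ wt v

monomial-∷ : ∀ x y a (v : F₂^ n) → monomial x y (a ∷ v) ≈ select x y a * monomial x y v
monomial-∷ {n} x y 0ℙ v = trans
  -- Subtraction is truncated: the exponent grows by one only because `wt v` is at most n.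
  (reflexive (≡.cong (λ k → x ^ k * y ^ wt v) (ℕ.+-∸-assoc 1 (count≤n (λ a → ¬? (a ℙ.≟ 0ℙ)) v))))
  (*-assoc x (x ^ (n ℕ.∸ wt v)) (y ^ wt v))
monomial-∷ {n} x y 1ℙ v =
  solve 3 (λ p y q → p :* (y :* q) := y :* (p :* q)) refl (x ^ (n ℕ.∸ wt v)) y (y ^ wt v)

-- Homogeneity of degree n, used to extract the powers of 1/√2 from the dual enumerator.
monomial-scale : ∀ c x y (v : F₂^ n) → monomial (x * c) (y * c) v ≈ c ^ n * monomial x y v
monomial-scale c x y []      = sym (*-identityˡ (1# * 1#))
monomial-scale {suc n} c x y (a ∷ v) = begin
  monomial (x * c) (y * c) (a ∷ v)
    ≈⟨ monomial-∷ (x * c) (y * c) a v ⟩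
  select (x * c) (y * c) a * monomial (x * c) (y * c) v
    ≈⟨ *-cong (scale a) (monomial-scale c x y v) ⟩
  select x y a * c * (c ^ n * monomial x y v)
    ≈⟨ solve 4 (λ x c p m → x :* c :* (p :* m) := c :* p :* (x :* m))
         refl (select x y a) c (c ^ n) (monomial x y v) ⟩
  c * c ^ n * (select x y a * monomial x y v)
    ≈⟨ *-congˡ (monomial-∷ x y a v) ⟨
  c * c ^ n * monomial x y (a ∷ v) ∎
  where
  scale : ∀ a → select (x * c) (y * c) a ≈ select x y a * c
  scale 0ℙ = refl
  scale 1ℙ = refl

-- Homogeneous forms in t and ρ

module _ (t ρ : ℂ) where

  -- form d α = ∑_{k ≤ d} tᵏ ρᵈ⁻ᵏ αₖ
  form : ℕ → (ℕ → ℂ) → ℂ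
  form zero    α = α 0
  form (suc d) α = ρ ^ suc d * α 0 + t * form d (α ∘ suc)

  form-isLinear : ∀ d → IsLinear (form d)
  form-isLinear zero    = evaluation-isLinear 0
  form-isLinear (suc d) = +-isLinear (*-isLinear (ρ ^ suc d) (evaluation-isLinear 0))
    (*-isLinear t (∘-isLinear (form-isLinear d) λ k → evaluation-isLinear (suc k)))

  form-constant : ∀ d α → (∀ k → α (suc k) ≈ 0#) → form d α ≈ ρ ^ d * α 0
  form-constant zero    α α≈0 = sym (*-identityˡ (α 0))
  form-constant (suc d) α α≈0 = trans
    (+-congˡ (trans (*-congˡ (vanishes (form-isLinear d) α≈0)) (zeroʳ t)))
    (+-identityʳ (ρ ^ suc d * α 0))

  -- With the pure power of t gone, every remaining term contains ρ.
  form-suc : ∀ d α → α (suc d) ≈ 0# → form (suc d) α ≈ ρ * form d α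
  form-suc zero    α α₁≈0 = begin
    ρ * 1# * α 0 + t * α 1     ≈⟨ +-congˡ (trans (*-congˡ α₁≈0) (zeroʳ t)) ⟩
    ρ * 1# * α 0 + 0#          ≈⟨ solve 2 (λ r a → r :* con 1 :* a :+ con 0 := r :* a) refl ρ (α 0) ⟩
    ρ * α 0                    ∎
  form-suc (suc d) α α≈0 = begin
    ρ * ρ ^ suc d * α 0 + t * form (suc d) (α ∘ suc)
      ≈⟨ +-congˡ (*-congˡ (form-suc d (α ∘ suc) α≈0)) ⟩
    ρ * ρ ^ suc d * α 0 + t * (ρ * form d (α ∘ suc))
      ≈⟨ solve 5 (λ r p a t s → r :* p :* a :+ t :* (r :* s) := r :* (p :* a :+ t :* s)) refl
           ρ (ρ ^ suc d) (α 0) t (form d (α ∘ suc)) ⟩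
    ρ * form (suc d) α ∎

  -- Multiplication of a form by the linear factor s ρ + t, read off on coefficients. The vanishing
  -- of α at d + 1 says that α has degree at most d, so `form-suc` applies.
  form-shift : ∀ d s α β → α (suc d) ≈ 0# → β 0 ≈ s * α 0 → (∀ k → β (suc k) ≈ s * α (suc k) + α k) →
               form (suc d) β ≈ (s * ρ + t) * form d α
  form-shift d s α β α≈0 β₀ βₛ = begin
    ρ ^ suc d * β 0 + t * form d (β ∘ suc)
      ≈⟨ +-cong (*-congˡ β₀) (*-congˡ (cong (form-isLinear d) βₛ)) ⟩
    ρ ^ suc d * (s * α 0) + t * form d (λ k → s * α (suc k) + α k)
      ≈⟨ +-congˡ (*-congˡ (trans (additive (form-isLinear d) (λ k → s * α (suc k)) α)
           (+-congʳ (homogeneous (form-isLinear d) s (α ∘ suc))))) ⟩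
    ρ ^ suc d * (s * α 0) + t * (s * form d (α ∘ suc) + form d α)
      ≈⟨ solve 6 (λ p s a t x y → p :* (s :* a) :+ t :* (s :* x :+ y) := s :* (p :* a :+ t :* x) :+ t :* y) refl
           (ρ ^ suc d) s (α 0) t (form d (α ∘ suc)) (form d α) ⟩
    s * form (suc d) α + t * form d α
      ≈⟨ +-congʳ (*-congˡ (form-suc d α α≈0)) ⟩
    s * (ρ * form d α) + t * form d α
      ≈⟨ solve 4 (λ s r x t → s :* (r :* x) :+ t :* x := (s :* r :+ t) :* x) refl s ρ (form d α) t ⟩
    (s * ρ + t) * form d α ∎

-- Divided powers of characters

δ-χ-outside : ∀ (J : Subset n) → δ (χ (outside ∷ J)) ≗ℂ (λ _ → 0#)
δ-χ-outside J v = begin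
  δ (χ (outside ∷ J)) v                  ≈⟨ δ≈ (χ (outside ∷ J)) v ⟩
  ½ * (1# * χ J v + ε * (1# * χ J v))    ≈⟨ solve 3 (λ h z e → h :* (con 1 :* z :+ e :* (con 1 :* z)) := h :* z :* (con 1 :+ e))
                                              refl ½ (χ J v) ε ⟩
  ½ * χ J v * (1# + ε)                   ≈⟨ trans (*-congˡ 1+ε≈0) (zeroʳ (½ * χ J v)) ⟩
  0#                                     ∎

δ-χ-inside : ∀ (J : Subset n) → δ (χ (inside ∷ J)) ≗ℂ χ J
δ-χ-inside J v = begin
  δ (χ (inside ∷ J)) v                   ≈⟨ δ≈ (χ (inside ∷ J)) v ⟩
  ½ * (1# * χ J v + ε * (ε * χ J v))     ≈⟨ solve 3 (λ h z e → h :* (con 1 :* z :+ e :* (e :* z)) := h :* z :* (con 1 :+ e :* e))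
                                              refl ½ (χ J v) ε ⟩
  ½ * χ J v * (1# + ε * ε)               ≈⟨ *-congˡ (+-congˡ ε*ε≈1) ⟩
  ½ * χ J v * (1# + 1#)                  ≈⟨ solve 2 (λ h z → h :* z :* (con 1 :+ con 1) := (h :+ h) :* z)
                                              refl ½ (χ J v) ⟩
  (½ + ½) * χ J v                        ≈⟨ trans (*-congʳ ½+½≈1) (*-identityˡ (χ J v)) ⟩
  χ J v                                  ∎

e-χ-outside : ∀ (J : Subset n) k a v → e k (χ (outside ∷ J)) (a ∷ v) ≈ e k (χ J) v
e-χ-outside J zero    a v = *-identityˡ (χ J v)
e-χ-outside J (suc k) a v = trans
  (+-cong (cong (e-isLinear (suc k) v) λ w → *-identityˡ (χ J w)) (vanishes (e-isLinear k v) (δ-χ-outside J)))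
  (+-identityʳ (e (suc k) (χ J) v))

e-χ-inside : ∀ (J : Subset n) k a v →
  e (suc k) (χ (inside ∷ J)) (a ∷ v) ≈ sgn a * e (suc k) (χ J) v + e k (χ J) v
e-χ-inside J k a v =
  +-cong (homogeneous (e-isLinear (suc k) v) (sgn a) (χ J)) (cong (e-isLinear k v) (δ-χ-inside J))

-- A character is a product of |J| distinct signs, so more than |J| derivatives annihilate it.
e-χ-vanishes : ∀ (J : Subset n) {k} → ∣ J ∣ ℕ.< k → ∀ v → e k (χ J) v ≈ 0#
e-χ-vanishes []            {suc k} _       []      = refl
e-χ-vanishes (outside ∷ J) {k}     J<k     (a ∷ v) = trans (e-χ-outside J k a v) (e-χ-vanishes J J<k v)
e-χ-vanishes (inside ∷ J)  {suc k} (s≤s J<k) (a ∷ v) = begin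
  e (suc k) (χ (inside ∷ J)) (a ∷ v)        ≈⟨ e-χ-inside J k a v ⟩
  sgn a * e (suc k) (χ J) v + e k (χ J) v
    ≈⟨ +-cong (*-congˡ (e-χ-vanishes J (ℕ.m<n⇒m<1+n J<k) v)) (e-χ-vanishes J J<k v) ⟩
  sgn a * 0# + 0#                           ≈⟨ trans (+-identityʳ (sgn a * 0#)) (zeroʳ (sgn a)) ⟩
  0#                                        ∎

-- The weighted transform, from characters to harmonic polynomials

module _ (x y : ℂ) where

  private
    D t ρ a b : ℂ
    D = x ^ 2 - y ^ 2
    t = x * x + y * y
    ρ = ε * (two * (x * y))
    a = x + y
    b = x - y

  factor≈ : ∀ c → select a b c ≈ x + sgn c * y
  factor≈ 0ℙ = +-congˡ (sym (*-identityˡ y))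
  factor≈ 1ℙ = +-congˡ (sym (-1*x≈-x y))

  -- Both sides are (x + s y)(x - s y)².
  factor-swap : ∀ s → s * s ≈ 1# → (x + s * (ε * y)) * D ≈ (x + s * y) * (s * ρ + t)
  factor-swap s s²≈1 = begin
    (x + s * (ε * y)) * D
      ≈⟨ *-congˡ (+-congˡ (-1*x≈-x (y ^ 2))) ⟨
    (x + s * (ε * y)) * (x ^ 2 + ε * y ^ 2)
      -- Rewriting y² as (s y)² uses s² = 1 once and for all; what remains is an identity between
      -- polynomials in x and s y.
      ≈⟨ *-congˡ (+-congˡ (*-congˡ (square y))) ⟩
    (x + s * (ε * y)) * (x ^ 2 + ε * (s * y * (s * y)))
      -- The solver cannot use 1 + ε = 0, so each side receives a multiple of 1 + ε. The cofactors
      -- are chosen so that both sides agree as polynomials with natural coefficients, ε being an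
      -- indeterminate.
      ≈⟨ pad _ (x * x * (s * y) + x * (s * y * (s * y)) + s * y * (s * y * (s * y))) ⟩
    (x + s * (ε * y)) * (x ^ 2 + ε * (s * y * (s * y)))
      + (1# + ε) * (x * x * (s * y) + x * (s * y * (s * y)) + s * y * (s * y * (s * y)))
      ≈⟨ solve 4 (λ x y s e →
           (x :+ s :* (e :* y)) :* (x :* (x :* con 1) :+ e :* (s :* y :* (s :* y)))
             :+ (con 1 :+ e) :* (x :* x :* (s :* y) :+ x :* (s :* y :* (s :* y)) :+ s :* y :* (s :* y :* (s :* y))) :=
           (x :+ s :* y) :* (s :* (e :* ((con 1 :+ con 1) :* (x :* y))) :+ (x :* x :+ s :* y :* (s :* y)))
             :+ (con 1 :+ e) :* (e :* (s :* y :* (s :* y :* (s :* y))))) refl x y s ε ⟩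
    (x + s * y) * (s * ρ + (x * x + s * y * (s * y))) + (1# + ε) * (ε * (s * y * (s * y * (s * y))))
      ≈⟨ pad _ (ε * (s * y * (s * y * (s * y)))) ⟨
    (x + s * y) * (s * ρ + (x * x + s * y * (s * y)))
      ≈⟨ *-congˡ (+-congˡ (+-congˡ (trans (*-congˡ (sym (*-identityʳ y))) (square y)))) ⟨
    (x + s * y) * (s * ρ + t) ∎
    where
    pad : ∀ z w → z ≈ z + (1# + ε) * w
    pad z w = sym (trans (+-congˡ (trans (*-congʳ 1+ε≈0) (zeroˡ w))) (+-identityʳ z))
    square : ∀ z → z ^ 2 ≈ s * z * (s * z)
    square z = begin
      z * (z * 1#)        ≈⟨ *-identityˡ (z * (z * 1#)) ⟨
      1# * (z * (z * 1#)) ≈⟨ *-congʳ s²≈1 ⟨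
      s * s * (z * (z * 1#)) ≈⟨ solve 2 (λ s z → s :* s :* (z :* (z :* con 1)) := s :* z :* (s :* z))
                                  refl s z ⟩
      s * z * (s * z)     ∎

  -- A function that is a tensor product in its first coordinate has a transform with a separate
  -- factor for it. A coordinate outside J has s = 1, one inside has s = -1.
  walsh-monomial-∷ : ∀ c (u : F₂^ n) s (f : F₂^ (suc n) → ℂ) (g : F₂^ n → ℂ) →
    slice 0ℙ f ≗ℂ g → slice 1ℙ f ≗ℂ (λ v → s * g v) →
    walsh (c ∷ u) (λ v → monomial x y v * f v) ≈ (x + sgn c * (s * y)) * walsh u (λ v → monomial x y v * g v)
  walsh-monomial-∷ c u s f g f₀ f₁ = trans
    (cong (walsh-isLinear u) λ v → trans
      (+-cong (*-cong (monomial-∷ x y 0ℙ v) (f₀ v)) (*-congˡ (*-cong (monomial-∷ x y 1ℙ v) (f₁ v))))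
      (solve 6 (λ x y σ s m z → x :* m :* z :+ σ :* (y :* m :* (s :* z)) := (x :+ σ :* (s :* y)) :* (m :* z))
        refl x y (sgn c) s (monomial x y v) (g v)))
    (homogeneous (walsh-isLinear u) (x + sgn c * (s * y)) (λ v → monomial x y v * g v))

  -- Multiplying by the power of D instead of dividing keeps the identity valid for all x and y, and
  -- each element of J spends exactly one D in `factor-swap`.
  walsh-χ : ∀ (J : Subset n) u →
    walsh u (λ v → monomial x y v * χ J v) * D ^ ∣ J ∣ ≈ monomial a b u * form t ρ ∣ J ∣ (λ k → e k (χ J) u)
  walsh-χ [] [] = *-identityʳ (1# * 1# * 1#)
  walsh-χ (outside ∷ J) (c ∷ u) = begin
    walsh (c ∷ u) (λ v → monomial x y v * χ (outside ∷ J) v) * D ^ ∣ J ∣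
      ≈⟨ *-congʳ (walsh-monomial-∷ c u 1# (χ (outside ∷ J)) (χ J) (λ v → *-identityˡ (χ J v)) (λ _ → refl)) ⟩
    (x + sgn c * (1# * y)) * W * D ^ ∣ J ∣
      ≈⟨ *-assoc _ W (D ^ ∣ J ∣) ⟩
    (x + sgn c * (1# * y)) * (W * D ^ ∣ J ∣)
      ≈⟨ *-cong (trans (+-congˡ (*-congˡ (*-identityˡ y))) (sym (factor≈ c))) (walsh-χ J u) ⟩
    select a b c * (monomial a b u * F)
      ≈⟨ *-assoc (select a b c) (monomial a b u) F ⟨
    select a b c * monomial a b u * F
      ≈⟨ *-cong (monomial-∷ a b c u) (cong (form-isLinear t ρ ∣ J ∣) λ k → e-χ-outside J k c u) ⟨
    monomial a b (c ∷ u) * form t ρ ∣ J ∣ (λ k → e k (χ (outside ∷ J)) (c ∷ u)) ∎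
    where
    W = walsh u (λ v → monomial x y v * χ J v)
    F = form t ρ ∣ J ∣ (λ k → e k (χ J) u)
  walsh-χ (inside ∷ J) (c ∷ u) = begin
    walsh (c ∷ u) (λ v → monomial x y v * χ (inside ∷ J) v) * (D * D ^ ∣ J ∣)
      ≈⟨ *-congʳ (walsh-monomial-∷ c u ε (χ (inside ∷ J)) (χ J) (λ v → *-identityˡ (χ J v)) (λ _ → refl)) ⟩
    (x + sgn c * (ε * y)) * W * (D * D ^ ∣ J ∣)
      ≈⟨ solve 4 (λ p w d q → p :* w :* (d :* q) := p :* d :* (w :* q))
           refl (x + sgn c * (ε * y)) W D (D ^ ∣ J ∣) ⟩
    (x + sgn c * (ε * y)) * D * (W * D ^ ∣ J ∣)
      ≈⟨ *-cong (factor-swap (sgn c) (sgn*sgn≈1 c)) (walsh-χ J u) ⟩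
    (x + sgn c * y) * (sgn c * ρ + t) * (monomial a b u * F)
      ≈⟨ *-congʳ (*-congʳ (factor≈ c)) ⟨
    select a b c * (sgn c * ρ + t) * (monomial a b u * F)
      ≈⟨ solve 4 (λ p q m f → p :* q :* (m :* f) := p :* m :* (q :* f))
           refl (select a b c) (sgn c * ρ + t) (monomial a b u) F ⟩
    select a b c * monomial a b u * ((sgn c * ρ + t) * F)
      -- The new element of J contributes the factor s ρ + t. The top coefficient demanded by
      -- `form-shift` vanishes by degree, since |J| < |J| + 1.
      ≈⟨ *-cong (monomial-∷ a b c u) (form-shift t ρ ∣ J ∣ (sgn c) (λ k → e k (χ J) u) (λ k → e k (χ (inside ∷ J)) (c ∷ u))
           (e-χ-vanishes J ℕ.≤-refl u) refl (λ k → e-χ-inside J k c u)) ⟨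
    monomial a b (c ∷ u) * form t ρ (suc ∣ J ∣) (λ k → e k (χ (inside ∷ J)) (c ∷ u)) ∎
    where
    W = walsh u (λ v → monomial x y v * χ J v)
    F = form t ρ ∣ J ∣ (λ k → e k (χ J) u)

  walsh-harmonic : ∀ {Q : F₂^ n → ℂ} → Q ∈𝒟⁰ d → ∀ u →
    D ^ d * walsh u (λ v → monomial x y v * Q v) ≈ ρ ^ d * (monomial a b u * Q u)
  walsh-harmonic {d = d} {Q} (Q∈𝒟 , X̃′Q≈0) u = begin
    D ^ d * walsh u (λ v → monomial x y v * Q v)
      ≈⟨ linear-ext-𝒟
           (*-isLinear (D ^ d) (∘-isLinear (walsh-isLinear u) λ v → *-isLinear (monomial x y v) (evaluation-isLinear v)))
           (*-isLinear (monomial a b u) (∘-isLinear (form-isLinear t ρ d) λ k → e-isLinear k u))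
           (λ { J ≡.refl → trans (*-comm (D ^ d) _) (walsh-χ J u) })
           Q∈𝒟 ⟩
    monomial a b u * form t ρ d (λ k → e k Q u)
      ≈⟨ *-congˡ (form-constant t ρ d (λ k → e k Q u) λ k → e-harmonic X̃′Q≈0 k u) ⟩
    monomial a b u * (ρ ^ d * Q u)
      ≈⟨ solve 3 (λ m r q → m :* (r :* q) := r :* (m :* q)) refl (monomial a b u) (ρ ^ d) (Q u) ⟩
    ρ ^ d * (monomial a b u * Q u) ∎

-- From the transform to the weight enumerators

weightEnumerator-monomial : ∀ (C : Code n) Q x y →
  weightEnumerator C Q x y ≈ sumOver (Code.codewords C) (λ c → monomial x y c * Q c)
weightEnumerator-monomial {n} C Q x y = cong (sumOver-isLinear (Code.codewords C)) λ c →
  solve 3 (λ q p r → q :* p :* r := p :* r :* q) refl (Q c) (x ^ (n ℕ.∸ wt c)) (y ^ wt c)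

theorem5p1 : ∀ (n : ℕ) (C : Code n) (d : ℕ) (Q : F₂^ n → ℂ) → Q ∈𝒟⁰ d →
    ∀ (x y : ℂ) (x²-y²#0 : x ^ 2 - y ^ 2 #0) →
    weightEnumerator C Q x y ≈
    (- ((x * y) ÷ (x ^ 2 - y ^ 2) by x²-y²#0)) ^ d
    * ((√2 ^ n * fromℕ 2 ^ d) ÷ fromℕ (size (C ⊥)) by size#0 (C ⊥))
    * weightEnumerator (C ⊥) Q ((x + y) ÷ √2 by √2#0) ((x - y) ÷ √2 by √2#0)
theorem5p1 n C d Q Q∈𝒟⁰ x y x²-y²#0 = sym (begin
  P ^ d * (√2 ^ n * fromℕ 2 ^ d * N⁻¹) * weightEnumerator (C ⊥) Q ((x + y) * √2⁻¹) ((x - y) * √2⁻¹)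
    ≈⟨ *-congˡ dual ⟩
  P ^ d * (√2 ^ n * fromℕ 2 ^ d * N⁻¹) * (√2⁻¹ ^ n * S)
    ≈⟨ solve 6 (λ p r t m i s → p :* (r :* t :* m) :* (i :* s) := r :* i :* (m :* (p :* t :* s))) refl
         (P ^ d) (√2 ^ n) (fromℕ 2 ^ d) N⁻¹ (√2⁻¹ ^ n) S ⟩
  √2 ^ n * √2⁻¹ ^ n * (N⁻¹ * (P ^ d * fromℕ 2 ^ d * S))
    -- The factor 2^{n/2} of the statement, written as a power of √2, cancels the scaling of the
    -- dual arguments.
    ≈⟨ *-cong (cancel-^ √2 √2⁻¹ n (*-inverse √2 √2#0)) (*-congˡ (*-congʳ scalar)) ⟩
  1# * (N⁻¹ * (D⁻¹ ^ d * ρ ^ d * S))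
    ≈⟨ solve 4 (λ m i r s → con 1 :* (m :* (i :* r :* s)) := m :* (i :* (r :* s)))
         refl N⁻¹ (D⁻¹ ^ d) (ρ ^ d) S ⟩
  N⁻¹ * (D⁻¹ ^ d * (ρ ^ d * S))
    ≈⟨ *-congˡ (*-congˡ transform) ⟨
  N⁻¹ * (D⁻¹ ^ d * (D ^ d * (N * W)))
    ≈⟨ solve 5 (λ m i d n w → m :* (i :* (d :* (n :* w))) := n :* m :* (d :* i :* w))
         refl N⁻¹ (D⁻¹ ^ d) (D ^ d) N W ⟩
  N * N⁻¹ * (D ^ d * D⁻¹ ^ d * W)
    ≈⟨ *-cong (*-inverse N (size#0 (C ⊥))) (*-congʳ (cancel-^ D D⁻¹ d (*-inverse D x²-y²#0))) ⟩
  1# * (1# * W)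
    ≈⟨ solve 1 (λ w → con 1 :* (con 1 :* w) := w) refl W ⟩
  W
    ≈⟨ weightEnumerator-monomial C Q x y ⟨
  weightEnumerator C Q x y ∎)
  where
  D D⁻¹ P ρ N N⁻¹ √2⁻¹ W S : ℂ
  D    = x ^ 2 - y ^ 2
  D⁻¹  = inverse D x²-y²#0
  P    = - ((x * y) * D⁻¹)
  ρ    = ε * (two * (x * y))
  N    = fromℕ (size (C ⊥))
  N⁻¹  = inverse N (size#0 (C ⊥))
  √2⁻¹ = inverse √2 √2#0
  W    = sumOver (Code.codewords C) (λ v → monomial x y v * Q v)
  S    = sumOver (Code.codewords (C ⊥)) (λ u → monomial (x + y) (x - y) u * Q u)

  sum⊥-isLinear : IsLinear (sumOver (Code.codewords (C ⊥)))
  sum⊥-isLinear = sumOver-isLinear (Code.codewords (C ⊥))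

  cancel-^ : ∀ z w k → z * w ≈ 1# → z ^ k * w ^ k ≈ 1#
  cancel-^ z w zero    eq = *-identityˡ 1#
  cancel-^ z w (suc k) eq = begin
    z * z ^ k * (w * w ^ k)
      ≈⟨ solve 4 (λ z p w q → z :* p :* (w :* q) := z :* w :* (p :* q)) refl z (z ^ k) w (w ^ k) ⟩
    z * w * (z ^ k * w ^ k)   ≈⟨ *-cong eq (cancel-^ z w k eq) ⟩
    1# * 1#                   ≈⟨ *-identityˡ 1# ⟩
    1#                        ∎

  dual : weightEnumerator (C ⊥) Q ((x + y) * √2⁻¹) ((x - y) * √2⁻¹) ≈ √2⁻¹ ^ n * S
  dual = begin
    weightEnumerator (C ⊥) Q ((x + y) * √2⁻¹) ((x - y) * √2⁻¹)
      ≈⟨ weightEnumerator-monomial (C ⊥) Q ((x + y) * √2⁻¹) ((x - y) * √2⁻¹) ⟩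
    sumOver (Code.codewords (C ⊥)) (λ u → monomial ((x + y) * √2⁻¹) ((x - y) * √2⁻¹) u * Q u)
      ≈⟨ cong sum⊥-isLinear (λ u → trans (*-congʳ (monomial-scale √2⁻¹ (x + y) (x - y) u)) (*-assoc _ _ (Q u))) ⟩
    sumOver (Code.codewords (C ⊥)) (λ u → √2⁻¹ ^ n * (monomial (x + y) (x - y) u * Q u))
      ≈⟨ homogeneous sum⊥-isLinear (√2⁻¹ ^ n) _ ⟩
    √2⁻¹ ^ n * S ∎

  -- The power 2^d is absorbed here: twice -xy/(x² - y²) is ρ/D.
  scalar : P ^ d * fromℕ 2 ^ d ≈ D⁻¹ ^ d * ρ ^ d
  scalar = begin
    P ^ d * fromℕ 2 ^ d     ≈⟨ ^-distrib-* P (fromℕ 2) d ⟨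
    (P * fromℕ 2) ^ d       ≈⟨ ^-congˡ d (begin
      P * fromℕ 2                       ≈⟨ *-congʳ (-1*x≈-x ((x * y) * D⁻¹)) ⟨
      ε * ((x * y) * D⁻¹) * fromℕ 2     ≈⟨ solve 4 (λ e x y i → e :* ((x :* y) :* i) :* (con 1 :+ (con 1 :+ con 0)) :=
                                             i :* (e :* ((con 1 :+ con 1) :* (x :* y)))) refl ε x y D⁻¹ ⟩
      D⁻¹ * ρ                           ∎) ⟩
    (D⁻¹ * ρ) ^ d           ≈⟨ ^-distrib-* D⁻¹ ρ d ⟩
    D⁻¹ ^ d * ρ ^ d         ∎

  -- The theorem with all denominators cleared; it holds even where x² = y².
  transform : D ^ d * (N * W) ≈ ρ ^ d * S
  transform = begin
    D ^ d * (N * W)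
      ≈⟨ *-congˡ (poisson C (λ v → monomial x y v * Q v)) ⟩
    D ^ d * sumOver (Code.codewords (C ⊥)) (λ u → walsh u (λ v → monomial x y v * Q v))
      ≈⟨ homogeneous sum⊥-isLinear (D ^ d) _ ⟨
    sumOver (Code.codewords (C ⊥)) (λ u → D ^ d * walsh u (λ v → monomial x y v * Q v))
      ≈⟨ cong sum⊥-isLinear (walsh-harmonic x y Q∈𝒟⁰) ⟩
    sumOver (Code.codewords (C ⊥)) (λ u → ρ ^ d * (monomial (x + y) (x - y) u * Q u))
      ≈⟨ homogeneous sum⊥-isLinear (ρ ^ d) _ ⟩
    ρ ^ d * S ∎
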